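{- Let $P$ be any finite poset. Then, as $n\to\infty$, $$\operatorname{La}^{\#}(n,P)\sim\frac{|P|}{c(P)}\binom{n}{\lfloor n/2\rfloor},$$ where $\operatorname{La}^{\#}(n,P)$ and $c(P)$ are as defined in the context.
   Context: For $n\ge 0$, $\mathcal{B}_n$ denotes the Boolean lattice: the family of all subsets of $[n]=\{1,\dots,n\}$ ordered by inclusion. A weak embedding of a finite poset $P$ into $\mathcal{B}_n$ is an injective map $f:P\to\mathcal{B}_n$ such that $a<b$ in $P$ implies $f(a)\subsetneq f(b)$; its image $f(P)$ is called a copy of $P$ in $\mathcal{B}_n$. Copies $\mathcal{F}_1,\mathcal{F}_2,\dots$ of $P$ are pairwise unrelated if whenever $i\ne j$, $A\in\mathcal{F}_i$ and $A'\in\mathcal{F}_j$, the sets $A$ and $A'$ are incomparable under inclusion (neither contains the other). $\operatorname{La}^{\#}(n,P)$ denotes the maximum of $|\bigcup_i\mathcal{F}_i|$ over all families of pairwise unrelated copies $\mathcal{F}_i$ of $P$ in $\mathcal{B}_n$. For $\mathcal{F}\subseteq\mathcal{B}_k$, its convex closure is $\overline{\mathcal{F}}=\{S\in\mathcal{B}_k : A\subseteq S\subseteq B \text{ for some } A,B\in\mathcal{F}\}$. Finally, $c(P)$ is the minimum of $|\overline{f(P)}|$ over all $k\ge0$ and all weak embeddings $f$ of $P$ into $\mathcal{B}_k$. -}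

module Defs where

open import Data.Nat using (ℕ; zero; suc; _≤_; _*_; _/_; ∣_-_∣)
open import Data.Nat.Combinatorics using (_C_)
open import Data.Bool using (Bool; true; false)
open import Data.Bool.Properties renaming (_≟_ to _≟B_)
open import Data.Fin using (Fin)
open import Data.Fin.Properties using (any?)
open import Data.Fin.Subset using (Subset; _⊆_; inside; outside)
open import Data.Fin.Subset.Properties using (_⊆?_)
open import Data.Vec using (_∷_; [])
open import Data.Vec.Properties using (≡-dec)
open import Data.List using (List; []; _∷_; _++_; map; filter; length)
open import Data.Product using (Σ; ∃; _×_; _,_)
open import Data.Sum using (_⊎_)
open import Relation.Nullary using (¬_; Dec)
open import Relation.Nullary.Decidable using (_×-dec_)
open import Relation.Binary.PropositionalEquality using (_≡_; _≢_)

allSubsets : (n : ℕ) → List (Subset n)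
allSubsets zero = [] ∷ []
allSubsets (suc n) = map (outside ∷_) (allSubsets n) ++ map (inside ∷_) (allSubsets n)

count : {n : ℕ} (Q : Subset n → Set) → ((S : Subset n) → Dec (Q S)) → ℕ
count {n} Q Q? = length (filter Q? (allSubsets n))

_⊊_ : {n : ℕ} → Subset n → Subset n → Set
A ⊊ B = A ⊆ B × A ≢ B

-- A finite poset P with |P| = p elements is (Fin p, _≼_) with _≼_ a partial order.
-- Weak embedding of P into B_n.
IsWeakEmbedding : {p : ℕ} (_≼_ : Fin p → Fin p → Set) {n : ℕ} → (Fin p → Subset n) → Set
IsWeakEmbedding {p} _≼_ f =
  ((a b : Fin p) → f a ≡ f b → a ≡ b) ×
  ((a b : Fin p) → a ≼ b → a ≢ b → f a ⊊ f b)

InClosure : {p k : ℕ} → (Fin p → Subset k) → Subset k → Set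
InClosure {p} f S = ∃ λ (a : Fin p) → ∃ λ (b : Fin p) → (f a ⊆ S) × (S ⊆ f b)

closureSize : {p k : ℕ} → (Fin p → Subset k) → ℕ
closureSize {p} f = count (InClosure f)
  (λ S → any? (λ a → any? (λ b → (f a ⊆? S) ×-dec (S ⊆? f b))))

IsC : {p : ℕ} (_≼_ : Fin p → Fin p → Set) → ℕ → Set
IsC {p} _≼_ m =
  (∃ λ (k : ℕ) → Σ (Fin p → Subset k) λ f → IsWeakEmbedding _≼_ f × closureSize f ≡ m) ×
  ((k : ℕ) (f : Fin p → Subset k) → IsWeakEmbedding _≼_ f → m ≤ closureSize f)

Incomparable : {n : ℕ} → Subset n → Subset n → Set
Incomparable A B = ¬ (A ⊆ B) × ¬ (B ⊆ A)

PairwiseUnrelated : {p n t : ℕ} → (Fin t → Fin p → Subset n) → Set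
PairwiseUnrelated {p} {n} {t} F =
  (i j : Fin t) → i ≢ j → (a b : Fin p) → Incomparable (F i a) (F j b)

InUnion : {p n t : ℕ} → (Fin t → Fin p → Subset n) → Subset n → Set
InUnion {p} {n} {t} F S = ∃ λ (i : Fin t) → ∃ λ (a : Fin p) → F i a ≡ S

unionSize : {p n t : ℕ} → (Fin t → Fin p → Subset n) → ℕ
unionSize F = count (InUnion F) (λ S → any? (λ i → any? (λ a → ≡-dec _≟B_ (F i a) S)))

Achievable : {p : ℕ} (_≼_ : Fin p → Fin p → Set) (n m : ℕ) → Set
Achievable {p} _≼_ n m =
  ∃ λ (t : ℕ) → Σ (Fin t → Fin p → Subset n) λ F →
    ((i : Fin t) → IsWeakEmbedding _≼_ (F i)) × PairwiseUnrelated F × unionSize F ≡ m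

IsLaSharp : {p : ℕ} (_≼_ : Fin p → Fin p → Set) (n m : ℕ) → Set
IsLaSharp _≼_ n m = Achievable _≼_ n m × (∀ m' → Achievable _≼_ n m' → m' ≤ m)

{-# OPTIONS --safe #-}
module Submission where

-- Upper bound.  The convex closures of unrelated copies are unrelated, so a full chain of B_n meets
-- at most one of them.  If some member of a closure lies within a bounded distance of the top level,
-- the chains through it alone already number at least c · n! / M, where M = C(n, ⌊n/2⌋).  Otherwise
-- take c members of the closure: each lies on at least n! / M chains, and the chains through two of
-- them are negligible, so the closure meets (c − o(1)) · n! / M chains.
--
-- Lower bound.  Let f embed P in B_k with closure G of size c.  Split [n] into a block of size k and
-- the rest: the sets f a ++ T, with T in a fixed layer near the middle, form copies of P, and for
-- each R ∉ G one recurses in the rest on the sets R ++ _ , at a layer shifted by a constant which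
-- depends on R.  As R is not both above and below members of G, the shifts can be chosen so that all
-- copies are unrelated.  After J rounds the number t of copies satisfies, up to an error that
-- vanishes as n → ∞, 1 − c t / M ≤ (1 − c / 2^k)^J.
open import Defs
open import Data.Bool using (if_then_else_)
open import Data.Bool.Properties using () renaming (_≟_ to _≟ᵇ_)
open import Data.Empty using (⊥-elim)
open import Data.Fin using (Fin) renaming (_≟_ to _≟ᶠ_)
open import Data.Fin.Properties using (any?; injective⇒≤)
open import Data.Fin.Subset using (Subset; _⊆_; inside; outside; ∣_∣)
open import Data.Fin.Subset.Properties using (_⊆?_; ⊆-refl; ⊆-reflexive; ⊆-trans; drop-∷-⊆; out⊆; in⊆in; p⊆q⇒∣p∣≤∣q∣; ∣p∣≤n)
open import Data.List using (List; []; _∷_; _++_; map; filter; length; concat; take; lookup; downFrom; allFin; cartesianProduct; cartesianProductWith)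
open import Data.List.Properties using (length-++; length-map; length-take; length-tabulate; filter-some)
open import Data.List.Membership.Propositional using (_∈_; lose; find)
open import Data.List.Membership.Propositional.Properties using (∈-map⁺; ∈-map⁻; ∈-++⁺ˡ; ∈-++⁺ʳ; ∈-lookup; ∈-filter⁺; ∈-filter⁻; ∈-allFin; ∈-cartesianProductWith⁺; ∈-cartesianProductWith⁻)
open import Data.List.Membership.Setoid.Properties using (index-injective)
open import Data.List.Relation.Unary.All as All using (All; []; _∷_; all?)
import Data.List.Relation.Unary.All.Properties as All
open import Data.List.Relation.Unary.AllPairs as AllPairs using (AllPairs; []; _∷_)
import Data.List.Relation.Unary.AllPairs.Properties as AllPairs
open import Data.List.Relation.Unary.Any as Any using (Any; here)
open import Data.List.Relation.Unary.Unique.Propositional using (Unique)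
import Data.List.Relation.Unary.Unique.Propositional.Properties as Unique
open import Data.Nat
open import Data.Nat.Combinatorics using (_C_; nCk≡n!/k![n-k]!; k![n∸k]!∣n!; k>n⇒nCk≡0; nCk≡nC[n∸k]; nCk+nC[k+1]≡[n+1]C[k+1])
open import Data.Nat.DivMod using (m≡m%n+[m/n]*n; m%n<n; m/n*n≤m; m/n*n≡m; m*n/n≡m; /-monoˡ-≤; +-distrib-/-∣ʳ)
open import Data.Nat.Divisibility using (n∣m*n)
open import Data.Nat.Properties
open import Data.Nat.Tactic.RingSolver using (solve-∀)
open import Data.Product using (∃; _×_; _,_; proj₁; proj₂)
open import Data.Sum using (_⊎_; inj₁; inj₂) renaming (map to map⊎)
open import Data.Unit using (⊤; tt)
open import Data.Vec using ([]; _∷_; here) renaming (_++_ to _++ᵛ_)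
open import Data.Vec.Properties using (≡-dec; ∷-injectiveʳ; ++-injectiveˡ; ++-injectiveʳ)
open import Function using (_∘_; id; case_of_)
open import Relation.Binary.PropositionalEquality using (_≡_; _≢_; refl; sym; trans; cong; cong₂; subst; subst₂; setoid; module ≡-Reasoning)
open import Relation.Binary.Structures using (IsPartialOrder)
open import Relation.Nullary using (Dec; yes; no; does; ¬_; contradiction)
open import Relation.Nullary.Decidable using (_×-dec_; ¬?)

-- Binomial coefficients and their size near the middle layer.

C-! : ∀ {n k} → k ≤ n → (n C k) * (k ! * (n ∸ k) !) ≡ n !
C-! {n} {k} k≤n = trans (cong (_* (k ! * (n ∸ k) !)) (nCk≡n!/k![n-k]! k≤n))
                        (m/n*n≡m {{k !* (n ∸ k) !≢0}} (k![n∸k]!∣n! k≤n))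

C-!-+ : ∀ r s → ((r + s) C r) * (r ! * s !) ≡ (r + s) !
C-!-+ r s = trans (cong (λ u → ((r + s) C r) * (r ! * u !)) (sym (m+n∸m≡n r s))) (C-! (m≤m+n r s))

C-absorb-+ : ∀ r s → suc r * ((suc r + s) C suc r) ≡ suc s * ((suc r + s) C r)
C-absorb-+ r s = *-cancelʳ-≡ _ _ (r ! * s !) {{r !* s !≢0}} (begin
    suc r * X * (r ! * s !)                ≡⟨ e₁ (suc r) X (r !) (s !) ⟩
    X * ((suc r) ! * s !)                  ≡⟨ C-!-+ (suc r) s ⟩
    (suc r + s) !                          ≡⟨ cong _! (+-suc r s) ⟨
    (r + suc s) !                          ≡⟨ C-!-+ r (suc s) ⟨
    ((r + suc s) C r) * (r ! * (suc s) !)  ≡⟨ cong (λ m → (m C r) * (r ! * (suc s) !)) (+-suc r s) ⟩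
    Y * (r ! * (suc s) !)                  ≡⟨ e₂ (suc s) Y (r !) (s !) ⟩
    suc s * Y * (r ! * s !)                ∎)
  where
  open ≡-Reasoning
  X = (suc r + s) C suc r
  Y = (suc r + s) C r
  e₁ : ∀ a x u v → a * x * (u * v) ≡ x * (a * u * v)
  e₁ = solve-∀
  e₂ : ∀ a x u v → x * (u * (a * v)) ≡ a * x * (u * v)
  e₂ = solve-∀

C-absorb : ∀ n r → suc r * (n C suc r) ≡ (n ∸ r) * (n C r)
C-absorb n r with suc r ≤? n
... | no r≮n = begin
    suc r * (n C suc r)  ≡⟨ cong (suc r *_) (k>n⇒nCk≡0 (≰⇒> r≮n)) ⟩
    suc r * 0            ≡⟨ *-zeroʳ r ⟩
    0                    ≡⟨ cong (_* (n C r)) (m≤n⇒m∸n≡0 (≤-pred (≰⇒> r≮n))) ⟨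
    (n ∸ r) * (n C r)    ∎
  where open ≡-Reasoning
... | yes r<n = begin
    suc r * (n C suc r)                        ≡⟨ cong (λ m → suc r * (m C suc r)) n≡ ⟨
    suc r * ((suc r + s) C suc r)              ≡⟨ C-absorb-+ r s ⟩
    suc s * ((suc r + s) C r)                  ≡⟨ cong₂ (λ u m → u * (m C r)) (sym (+-∸-assoc 1 r<n)) n≡ ⟩
    (n ∸ r) * (n C r)                          ∎
  where
  open ≡-Reasoning
  s = n ∸ suc r
  n≡ : suc r + s ≡ n
  n≡ = m+[n∸m]≡n r<n

half+half≤ : ∀ n → n / 2 + n / 2 ≤ n
half+half≤ n = subst (_≤ n) (e (n / 2)) (m/n*n≤m n 2)
  where e : ∀ h → h * 2 ≡ h + h
        e = solve-∀

≤suc-half+half : ∀ n → n ≤ suc (n / 2 + n / 2)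
≤suc-half+half n = begin
  n                      ≡⟨ m≡m%n+[m/n]*n n 2 ⟩
  n % 2 + n / 2 * 2      ≤⟨ +-monoˡ-≤ (n / 2 * 2) (≤-pred (m%n<n n 2)) ⟩
  1 + n / 2 * 2          ≡⟨ e (n / 2) ⟩
  suc (n / 2 + n / 2)    ∎
  where open ≤-Reasoning
        e : ∀ h → 1 + h * 2 ≡ suc (h + h)
        e = solve-∀

-- By absorption the ratio of the two coefficients is (n - r) / (r + 1), which is at most 1 from the
-- middle on.
C-decreasing : ∀ n r → n / 2 ≤ r → n C suc r ≤ n C r
C-decreasing n r h≤r = *-cancelˡ-≤ (suc r) (begin
  suc r * (n C suc r)  ≡⟨ C-absorb n r ⟩
  (n ∸ r) * (n C r)    ≤⟨ *-monoˡ-≤ (n C r) (m≤n+o⇒m∸n≤o n r n≤r+1+r) ⟩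
  suc r * (n C r)      ∎)
  where
  open ≤-Reasoning
  n≤r+1+r : n ≤ r + suc r
  n≤r+1+r = subst (n ≤_) (sym (+-suc r r)) (≤-trans (≤suc-half+half n) (s≤s (+-mono-≤ h≤r h≤r)))

C-upper≤central : ∀ n d → n C (n / 2 + d) ≤ n C (n / 2)
C-upper≤central n zero    = ≤-reflexive (cong (n C_) (+-identityʳ (n / 2)))
C-upper≤central n (suc d) rewrite +-suc (n / 2) d =
  ≤-trans (C-decreasing n (n / 2 + d) (m≤m+n (n / 2) d)) (C-upper≤central n d)

-- Above the middle the coefficients decrease; an index below the middle is first reflected to n -
-- r.
C≤central : ∀ n r → n C r ≤ n C (n / 2)
C≤central n r with ≤-total (n / 2) r
... | inj₁ h≤r = subst (λ s → n C s ≤ n C (n / 2)) (m+[n∸m]≡n h≤r) (C-upper≤central n (r ∸ n / 2))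
... | inj₂ r≤h = begin
  n C r                              ≡⟨ nCk≡nC[n∸k] (≤-trans r≤h (≤-trans (m≤m+n _ _) (half+half≤ n))) ⟩
  n C (n ∸ r)                        ≡⟨ cong (n C_) (m+[n∸m]≡n h≤n∸r) ⟨
  n C (n / 2 + (n ∸ r ∸ n / 2))      ≤⟨ C-upper≤central n (n ∸ r ∸ n / 2) ⟩
  n C (n / 2)                        ∎
  where
  open ≤-Reasoning
  h≤n∸r : n / 2 ≤ n ∸ r
  h≤n∸r = m+n≤o⇒m≤o∸n (n / 2) (≤-trans (+-monoʳ-≤ (n / 2) r≤h) (half+half≤ n))

central-suc≤ : ∀ n → suc n C (suc n / 2) ≤ 2 * (n C (n / 2))
central-suc≤ n with suc n / 2
... | zero  = m≤n⇒m≤n+o _ (C≤central n 0)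
... | suc r = begin
  suc n C suc r              ≡⟨ nCk+nC[k+1]≡[n+1]C[k+1] n r ⟨
  n C r + n C suc r          ≤⟨ +-mono-≤ (C≤central n r) (C≤central n (suc r)) ⟩
  M + M                      ≡⟨ cong (M +_) (+-identityʳ M) ⟨
  2 * M                      ∎
  where open ≤-Reasoning
        M = n C (n / 2)

-- Pascal's rule doubles the central coefficient at most. The lower bound compares the cube with its
-- part outside a block of k elements by this inequality.
central-+≤ : ∀ k n → (k + n) C ((k + n) / 2) ≤ 2 ^ k * (n C (n / 2))
central-+≤ zero    n = ≤-reflexive (sym (+-identityʳ _))
central-+≤ (suc k) n = begin
  (suc k + n) C ((suc k + n) / 2)   ≤⟨ central-suc≤ (k + n) ⟩
  2 * ((k + n) C ((k + n) / 2))     ≤⟨ *-monoʳ-≤ 2 (central-+≤ k n) ⟩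
  2 * (2 ^ k * (n C (n / 2)))       ≡⟨ *-assoc 2 (2 ^ k) _ ⟨
  2 ^ suc k * (n C (n / 2))         ∎
  where open ≤-Reasoning

-- With δ the drop from index r = h + d to r + 1, absorption gives (r + 1) δ = ((r + 1) - (n - r))
-- C(n, r), and that difference is at most 2d + 1. Multiplying by h ≤ r + 1 avoids division.
C-step-near-centre : ∀ n d → let h = n / 2 in
  h * (n C (h + d)) ≤ h * (n C suc (h + d)) + suc (d + d) * (n C h)
C-step-near-centre n d = begin
  h * C₀                                    ≡⟨ cong (h *_) (m+[n∸m]≡n C₁≤C₀) ⟨
  h * (C₁ + δ)                              ≡⟨ *-distribˡ-+ h C₁ δ ⟩
  h * C₁ + h * δ                            ≤⟨ +-monoʳ-≤ (h * C₁) hδ≤ ⟩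
  h * C₁ + suc (d + d) * C₀                 ≤⟨ +-monoʳ-≤ (h * C₁) (*-monoʳ-≤ (suc (d + d)) (C≤central n (h + d))) ⟩
  h * C₁ + suc (d + d) * (n C h)            ∎
  where
  open ≤-Reasoning
  h = n / 2
  r = h + d
  C₀ = n C r
  C₁ = n C suc r
  C₁≤C₀ : C₁ ≤ C₀
  C₁≤C₀ = C-decreasing n r (m≤m+n h d)
  δ = C₀ ∸ C₁
  1+r≤ : suc r ≤ (n ∸ r) + suc (d + d)
  1+r≤ = begin
    suc (h + d)                          ≡⟨ cong (λ u → suc (u + d)) (m+n∸m≡n h h) ⟨
    suc (h + h ∸ h + d)                  ≤⟨ s≤s (+-monoˡ-≤ d (∸-monoˡ-≤ h (half+half≤ n))) ⟩
    suc (n ∸ h + d)                      ≤⟨ s≤s (+-monoˡ-≤ d (m≤n+m∸n (n ∸ h) d)) ⟩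
    suc (d + (n ∸ h ∸ d) + d)            ≡⟨ cong (λ u → suc (d + u + d)) (∸-+-assoc n h d) ⟩
    suc (d + (n ∸ r) + d)                ≡⟨ e d (n ∸ r) ⟩
    (n ∸ r) + suc (d + d)                ∎
    where e : ∀ d u → suc (d + u + d) ≡ u + suc (d + d)
          e = solve-∀
  hδ≤ : h * δ ≤ suc (d + d) * C₀
  hδ≤ = begin
    h * δ                                    ≤⟨ *-monoˡ-≤ δ (m≤n⇒m≤1+n (m≤m+n h d)) ⟩
    suc r * δ                                ≡⟨ *-distribˡ-∸ (suc r) C₀ C₁ ⟩
    suc r * C₀ ∸ suc r * C₁                  ≡⟨ cong (suc r * C₀ ∸_) (C-absorb n r) ⟩
    suc r * C₀ ∸ (n ∸ r) * C₀                ≤⟨ ∸-monoˡ-≤ ((n ∸ r) * C₀) (*-monoˡ-≤ C₀ 1+r≤) ⟩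
    ((n ∸ r) + suc (d + d)) * C₀ ∸ (n ∸ r) * C₀ ≡⟨ cong (_∸ (n ∸ r) * C₀) (*-distribʳ-+ C₀ (n ∸ r) (suc (d + d))) ⟩
    (n ∸ r) * C₀ + suc (d + d) * C₀ ∸ (n ∸ r) * C₀ ≡⟨ m+n∸m≡n ((n ∸ r) * C₀) _ ⟩
    suc (d + d) * C₀                         ∎

-- The losses of the single steps add up as 1 + 3 + ... + (2d - 1) = d². For bounded d the relative
-- loss d² / h thus vanishes as n grows.
central≤C-near-centre : ∀ n d → let h = n / 2 in
  h * (n C h) ≤ h * (n C (h + d)) + d * d * (n C h)
central≤C-near-centre n zero    rewrite +-identityʳ (n / 2) = m≤m+n _ _
central≤C-near-centre n (suc d) = begin
  h * M                                                   ≤⟨ central≤C-near-centre n d ⟩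
  h * (n C (h + d)) + d * d * M                           ≤⟨ +-monoˡ-≤ _ (C-step-near-centre n d) ⟩
  h * (n C suc (h + d)) + suc (d + d) * M + d * d * M     ≡⟨ e (h * (n C suc (h + d))) d M ⟩
  h * (n C suc (h + d)) + suc d * suc d * M               ≡⟨ cong (λ r → h * (n C r) + suc d * suc d * M) (+-suc h d) ⟨
  h * (n C (h + suc d)) + suc d * suc d * M               ∎
  where
  open ≤-Reasoning
  h = n / 2
  M = n C h
  e : ∀ a d m → a + suc (d + d) * m + d * d * m ≡ a + suc d * suc d * m
  e = solve-∀

-- Finite sums and indicators.

private variable
  A B : Set

∑ : List A → (A → ℕ) → ℕ
∑ []       f = 0
∑ (x ∷ xs) f = f x + ∑ xs f

infix 6.5 ∑
syntax ∑ xs (λ x → e) = ∑[ x ∈ xs ] e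

𝟙 : Dec A → ℕ
𝟙 d = if does d then 1 else 0

𝟙-yes : (d : Dec A) → A → 𝟙 d ≡ 1
𝟙-yes (yes _) a = refl
𝟙-yes (no ¬a) a = contradiction a ¬a

𝟙-no : (d : Dec A) → ¬ A → 𝟙 d ≡ 0
𝟙-no (yes a) ¬a = contradiction a ¬a
𝟙-no (no _)  ¬a = refl

𝟙-⇔ : (d : Dec A) (d′ : Dec B) → (A → B) → (B → A) → 𝟙 d ≡ 𝟙 d′
𝟙-⇔ (yes a) d′ f g = sym (𝟙-yes d′ (f a))
𝟙-⇔ (no ¬a) d′ f g = sym (𝟙-no d′ (¬a ∘ g))

𝟙-× : (d : Dec A) (d′ : Dec B) → 𝟙 (d ×-dec d′) ≡ 𝟙 d * 𝟙 d′
𝟙-× (yes _) d′ = sym (+-identityʳ (𝟙 d′))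
𝟙-× (no _)  d′ = refl

∑-cong : (xs : List A) {f g : A → ℕ} → (∀ x → f x ≡ g x) → ∑ xs f ≡ ∑ xs g
∑-cong []       eq = refl
∑-cong (x ∷ xs) eq = cong₂ _+_ (eq x) (∑-cong xs eq)

∑-mono : (xs : List A) {f g : A → ℕ} → (∀ x → f x ≤ g x) → ∑ xs f ≤ ∑ xs g
∑-mono []       le = z≤n
∑-mono (x ∷ xs) le = +-mono-≤ (le x) (∑-mono xs le)

∑-+ : (xs : List A) (f g : A → ℕ) → ∑[ x ∈ xs ] (f x + g x) ≡ ∑ xs f + ∑ xs g
∑-+ []       f g = refl
∑-+ (x ∷ xs) f g rewrite ∑-+ xs f g = e (f x) (g x) (∑ xs f) (∑ xs g)
  where e : ∀ a b c d → a + b + (c + d) ≡ a + c + (b + d)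
        e = solve-∀

∑-*ˡ : (xs : List A) (k : ℕ) (f : A → ℕ) → ∑[ x ∈ xs ] (k * f x) ≡ k * ∑ xs f
∑-*ˡ []       k f = sym (*-zeroʳ k)
∑-*ˡ (x ∷ xs) k f rewrite ∑-*ˡ xs k f = sym (*-distribˡ-+ k (f x) (∑ xs f))

∑-*ʳ : (xs : List A) (f : A → ℕ) (k : ℕ) → ∑[ x ∈ xs ] (f x * k) ≡ ∑ xs f * k
∑-*ʳ xs f k = trans (∑-cong xs λ x → *-comm (f x) k) (trans (∑-*ˡ xs k f) (*-comm k _))

∑-const : (xs : List A) (k : ℕ) → ∑[ x ∈ xs ] k ≡ length xs * k
∑-const []       k = refl
∑-const (x ∷ xs) k = cong (k +_) (∑-const xs k)

∑-swap : (xs : List A) (ys : List B) (f : A → B → ℕ) →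
         ∑[ x ∈ xs ] ∑[ y ∈ ys ] f x y ≡ ∑[ y ∈ ys ] ∑[ x ∈ xs ] f x y
∑-swap []       ys f = sym (trans (∑-const ys 0) (*-zeroʳ (length ys)))
∑-swap (x ∷ xs) ys f = begin
  ∑ ys (f x) + ∑[ x′ ∈ xs ] ∑ ys (f x′)                 ≡⟨ cong (∑ ys (f x) +_) (∑-swap xs ys f) ⟩
  ∑ ys (f x) + ∑[ y ∈ ys ] ∑[ x′ ∈ xs ] f x′ y          ≡⟨ ∑-+ ys (f x) (λ y → ∑[ x′ ∈ xs ] f x′ y) ⟨
  ∑[ y ∈ ys ] (f x y + ∑[ x′ ∈ xs ] f x′ y)             ∎
  where open ≡-Reasoning

∑-++ : (xs ys : List A) (f : A → ℕ) → ∑ (xs ++ ys) f ≡ ∑ xs f + ∑ ys f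
∑-++ []       ys f = refl
∑-++ (x ∷ xs) ys f = trans (cong (f x +_) (∑-++ xs ys f)) (sym (+-assoc (f x) _ _))

∑-map : (g : A → B) (xs : List A) (f : B → ℕ) → ∑ (map g xs) f ≡ ∑ xs (f ∘ g)
∑-map g []       f = refl
∑-map g (x ∷ xs) f = cong (f (g x) +_) (∑-map g xs f)

∑-cartesianProduct : (xs : List A) (ys : List B) (f : A × B → ℕ) →
                     ∑ (cartesianProduct xs ys) f ≡ ∑[ x ∈ xs ] ∑[ y ∈ ys ] f (x , y)
∑-cartesianProduct []       ys f = refl
∑-cartesianProduct (x ∷ xs) ys f =
  trans (∑-++ (map (x ,_) ys) _ f) (cong₂ _+_ (∑-map (x ,_) ys f) (∑-cartesianProduct xs ys f))

∑-downFrom-≥ : ∀ m lo → ∑[ j ∈ downFrom m ] 𝟙 (lo ≤? j) ≡ m ∸ lo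
∑-downFrom-≥ zero    lo = sym (0∸n≡0 lo)
∑-downFrom-≥ (suc m) lo with lo ≤? m
... | yes lo≤m = trans (cong₂ _+_ (𝟙-yes (lo ≤? m) lo≤m) (∑-downFrom-≥ m lo)) (sym (+-∸-assoc 1 lo≤m))
... | no  lo≰m = trans (cong₂ _+_ (𝟙-no (lo ≤? m) lo≰m) (∑-downFrom-≥ m lo))
                       (trans (m≤n⇒m∸n≡0 (<⇒≤ (≰⇒> lo≰m))) (sym (m≤n⇒m∸n≡0 (≰⇒> lo≰m))))

∑-downFrom-interval : ∀ m lo hi →
  ∑[ j ∈ downFrom m ] 𝟙 ((lo ≤? j) ×-dec (j <? hi)) ≡ (m ⊓ hi) ∸ lo
∑-downFrom-interval zero    lo hi = sym (0∸n≡0 lo)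
∑-downFrom-interval (suc m) lo hi with m <? hi
... | no m≮hi = begin
  𝟙 ((lo ≤? m) ×-dec (m <? hi)) + S   ≡⟨ cong (_+ S) (𝟙-no ((lo ≤? m) ×-dec (m <? hi)) (m≮hi ∘ proj₂)) ⟩
  S                                   ≡⟨ ∑-downFrom-interval m lo hi ⟩
  (m ⊓ hi) ∸ lo                       ≡⟨ cong (_∸ lo) (m≥n⇒m⊓n≡n (≮⇒≥ m≮hi)) ⟩
  hi ∸ lo                             ≡⟨ cong (_∸ lo) (m≥n⇒m⊓n≡n (m≤n⇒m≤1+n (≮⇒≥ m≮hi))) ⟨
  (suc m ⊓ hi) ∸ lo                   ∎
  where open ≡-Reasoning
        S = ∑[ j ∈ downFrom m ] 𝟙 ((lo ≤? j) ×-dec (j <? hi))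
... | yes m<hi = begin
  𝟙 ((lo ≤? m) ×-dec (m <? hi)) + S  ≡⟨ cong₂ _+_ (𝟙-⇔ ((lo ≤? m) ×-dec (m <? hi)) (lo ≤? m) proj₁ (_, m<hi))
                                                   (trans (∑-downFrom-interval m lo hi) (cong (_∸ lo) (m≤n⇒m⊓n≡m (<⇒≤ m<hi)))) ⟩
  𝟙 (lo ≤? m) + (m ∸ lo)              ≡⟨ cong (𝟙 (lo ≤? m) +_) (∑-downFrom-≥ m lo) ⟨
  𝟙 (lo ≤? m) + ∑[ j ∈ downFrom m ] 𝟙 (lo ≤? j) ≡⟨ ∑-downFrom-≥ (suc m) lo ⟩
  suc m ∸ lo                          ≡⟨ cong (_∸ lo) (m≤n⇒m⊓n≡m m<hi) ⟨
  (suc m ⊓ hi) ∸ lo                   ∎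
  where open ≡-Reasoning
        S = ∑[ j ∈ downFrom m ] 𝟙 ((lo ≤? j) ×-dec (j <? hi))

-- Full chains and the number of them through one or two sets.

-- A full chain C₀ ⊂ … ⊂ Cₙ of B_n and a level j ≤ n give the full chain
-- C₀ ⊂ … ⊂ C_j ⊂ C_j ∪ {x} ⊂ … ⊂ Cₙ ∪ {x} of B_{n+1}, where x is the new element.
Chain : ℕ → Set
Chain zero    = ⊤
Chain (suc n) = ℕ × Chain n

infix 4 _∈ᶜ_ _∈ᶜ?_

-- The only member of γ that S can equal is the one at level `∣ S ∣`. At level j the extended chain
-- contains both C_j and C_j ∪ {x}, so neither inequality is strict.
_∈ᶜ_ : ∀ {n} → Subset n → Chain n → Set
[]            ∈ᶜ _       = ⊤
(outside ∷ S) ∈ᶜ (j , γ) = ∣ S ∣ ≤ j × S ∈ᶜ γ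
(inside  ∷ S) ∈ᶜ (j , γ) = j ≤ ∣ S ∣ × S ∈ᶜ γ

_∈ᶜ?_ : ∀ {n} (S : Subset n) (γ : Chain n) → Dec (S ∈ᶜ γ)
[]            ∈ᶜ? _       = yes tt
(outside ∷ S) ∈ᶜ? (j , γ) = (∣ S ∣ ≤? j) ×-dec (S ∈ᶜ? γ)
(inside  ∷ S) ∈ᶜ? (j , γ) = (j ≤? ∣ S ∣) ×-dec (S ∈ᶜ? γ)

allChains : ∀ n → List (Chain n)
allChains zero    = tt ∷ []
allChains (suc n) = cartesianProduct (downFrom (suc n)) (allChains n)

∑-allChains-1 : ∀ n → ∑[ γ ∈ allChains n ] 1 ≡ n !
∑-allChains-1 zero    = refl
∑-allChains-1 (suc n) = begin
  ∑[ γ ∈ allChains (suc n) ] 1                        ≡⟨ ∑-cartesianProduct (downFrom (suc n)) (allChains n) (λ _ → 1) ⟩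
  ∑[ j ∈ downFrom (suc n) ] ∑[ γ ∈ allChains n ] 1    ≡⟨ ∑-cong (downFrom (suc n)) (λ _ → trans (∑-allChains-1 n) (sym (+-identityʳ (n !)))) ⟩
  ∑[ j ∈ downFrom (suc n) ] (1 * n !)                 ≡⟨ ∑-*ʳ (downFrom (suc n)) (λ _ → 1) (n !) ⟩
  (∑[ j ∈ downFrom (suc n) ] 1) * n !                 ≡⟨ cong (_* n !) (∑-downFrom-≥ (suc n) 0) ⟩
  (suc n) !                                           ∎
  where open ≡-Reasoning

in⊈out : ∀ {n} {S T : Subset n} {P : Set} → (inside ∷ S) ⊆ (outside ∷ T) → P
in⊈out i⊆o = case i⊆o here of λ ()

⊆∧∣≥∣⇒≡ : ∀ {n} {S T : Subset n} → S ⊆ T → ∣ T ∣ ≤ ∣ S ∣ → S ≡ T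
⊆∧∣≥∣⇒≡ {S = []}          {[]}          _   _  = refl
⊆∧∣≥∣⇒≡ {S = outside ∷ S} {outside ∷ T} S⊆T le = cong (outside ∷_) (⊆∧∣≥∣⇒≡ (drop-∷-⊆ S⊆T) le)
⊆∧∣≥∣⇒≡ {S = outside ∷ S} {inside  ∷ T} S⊆T le = contradiction (≤-trans le (p⊆q⇒∣p∣≤∣q∣ (drop-∷-⊆ S⊆T))) 1+n≰n
⊆∧∣≥∣⇒≡ {S = inside  ∷ S} {outside ∷ T} S⊆T le = in⊈out S⊆T
⊆∧∣≥∣⇒≡ {S = inside  ∷ S} {inside  ∷ T} S⊆T le = cong (inside ∷_) (⊆∧∣≥∣⇒≡ (drop-∷-⊆ S⊆T) (≤-pred le))

chain-total : ∀ {n} (S T : Subset n) (γ : Chain n) → S ∈ᶜ γ → T ∈ᶜ γ → S ⊆ T ⊎ T ⊆ S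
chain-total []            []            γ       _         _         = inj₁ ⊆-refl
chain-total (outside ∷ S) (outside ∷ T) (j , γ) (_ , S∈γ) (_ , T∈γ) = map⊎ out⊆ out⊆ (chain-total S T γ S∈γ T∈γ)
chain-total (inside  ∷ S) (inside  ∷ T) (j , γ) (_ , S∈γ) (_ , T∈γ) = map⊎ in⊆in in⊆in (chain-total S T γ S∈γ T∈γ)
chain-total (outside ∷ S) (inside  ∷ T) (j , γ) (s≤j , S∈γ) (j≤t , T∈γ) with chain-total S T γ S∈γ T∈γ
... | inj₁ S⊆T = inj₁ (out⊆ S⊆T)
-- Here the sizes satisfy s ≤ j ≤ t, so T ⊆ S forces S = T: this is the step of the chain that
-- inserts the new element.
... | inj₂ T⊆S rewrite ⊆∧∣≥∣⇒≡ T⊆S (≤-trans s≤j j≤t) = inj₁ (out⊆ ⊆-refl)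
chain-total (inside  ∷ S) (outside ∷ T) (j , γ) (j≤s , S∈γ) (t≤j , T∈γ) with chain-total S T γ S∈γ T∈γ
... | inj₂ T⊆S = inj₂ (out⊆ T⊆S)
... | inj₁ S⊆T rewrite ⊆∧∣≥∣⇒≡ S⊆T (≤-trans t≤j j≤s) = inj₂ (out⊆ ⊆-refl)

chainsThrough : ∀ {n} → Subset n → ℕ
chainsThrough {n} S = ∑[ γ ∈ allChains n ] 𝟙 (S ∈ᶜ? γ)

chainsThrough₂ : ∀ {n} → Subset n → Subset n → ℕ
chainsThrough₂ {n} S T = ∑[ γ ∈ allChains n ] 𝟙 (S ∈ᶜ? γ) * 𝟙 (T ∈ᶜ? γ)

private
  -- A chain of B_{n+1} is an independent choice of a level and of a chain of B_n, so conditions on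
  -- the two parts multiply.
  ∑-split : ∀ {n} (S T : Subset n) {P Q : ℕ → Set} (P? : ∀ j → Dec (P j)) (Q? : ∀ j → Dec (Q j)) →
    ∑[ γ ∈ allChains (suc n) ] 𝟙 (P? (proj₁ γ) ×-dec (S ∈ᶜ? proj₂ γ)) * 𝟙 (Q? (proj₁ γ) ×-dec (T ∈ᶜ? proj₂ γ))
      ≡ (∑[ j ∈ downFrom (suc n) ] 𝟙 (P? j ×-dec Q? j)) * chainsThrough₂ S T
  ∑-split {n} S T P? Q? = begin
    _ ≡⟨ ∑-cartesianProduct (downFrom (suc n)) (allChains n) _ ⟩
    (∑[ j ∈ downFrom (suc n) ] ∑[ γ ∈ allChains n ] 𝟙 (P? j ×-dec (S ∈ᶜ? γ)) * 𝟙 (Q? j ×-dec (T ∈ᶜ? γ)))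
      ≡⟨ ∑-cong (downFrom (suc n)) (λ j → trans (∑-cong (allChains n) (pointwise j)) (∑-*ˡ (allChains n) (𝟙 (P? j ×-dec Q? j)) _)) ⟩
    (∑[ j ∈ downFrom (suc n) ] 𝟙 (P? j ×-dec Q? j) * chainsThrough₂ S T)
      ≡⟨ ∑-*ʳ (downFrom (suc n)) (λ j → 𝟙 (P? j ×-dec Q? j)) (chainsThrough₂ S T) ⟩
    _ ∎
    where
    open ≡-Reasoning
    e : ∀ a b c d → a * b * (c * d) ≡ a * c * (b * d)
    e = solve-∀
    pointwise : ∀ j γ → 𝟙 (P? j ×-dec (S ∈ᶜ? γ)) * 𝟙 (Q? j ×-dec (T ∈ᶜ? γ))
                      ≡ 𝟙 (P? j ×-dec Q? j) * (𝟙 (S ∈ᶜ? γ) * 𝟙 (T ∈ᶜ? γ))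
    pointwise j γ rewrite 𝟙-× (P? j) (S ∈ᶜ? γ) | 𝟙-× (Q? j) (T ∈ᶜ? γ) | 𝟙-× (P? j) (Q? j) =
      e (𝟙 (P? j)) (𝟙 (S ∈ᶜ? γ)) (𝟙 (Q? j)) (𝟙 (T ∈ᶜ? γ))

-- By induction on the ground set. With s and t the sizes of the tails, the first element can be
-- inserted at n + 1 - t levels if it lies in neither set, at s + 1 levels if in both, and at t + 1
-- - s levels if only in T. In each case this number extends one of the three factorials.
chainsThrough₂-! : ∀ {n} (S T : Subset n) → S ⊆ T →
  chainsThrough₂ S T ≡ ∣ S ∣ ! * ((∣ T ∣ ∸ ∣ S ∣) ! * (n ∸ ∣ T ∣) !)
chainsThrough₂-! [] [] S⊆T = refl
chainsThrough₂-! (inside ∷ S) (outside ∷ T) S⊆T = in⊈out S⊆T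
chainsThrough₂-! {suc n} (outside ∷ S) (outside ∷ T) S⊆T = begin
  _ ≡⟨ ∑-split S T (∣ S ∣ ≤?_) (∣ T ∣ ≤?_) ⟩
  (∑[ j ∈ downFrom (suc n) ] 𝟙 ((s ≤? j) ×-dec (t ≤? j))) * chainsThrough₂ S T
    ≡⟨ cong₂ _*_ (trans (∑-cong (downFrom (suc n)) λ j → 𝟙-⇔ ((s ≤? j) ×-dec (t ≤? j)) (t ≤? j) proj₂ (λ t≤j → ≤-trans s≤t t≤j , t≤j))
                        (∑-downFrom-≥ (suc n) t))
                 (chainsThrough₂-! S T (drop-∷-⊆ S⊆T)) ⟩
  (suc n ∸ t) * (s ! * ((t ∸ s) ! * (n ∸ t) !))  ≡⟨ cong (_* (s ! * ((t ∸ s) ! * (n ∸ t) !))) (+-∸-assoc 1 (∣p∣≤n T)) ⟩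
  suc (n ∸ t) * (s ! * ((t ∸ s) ! * (n ∸ t) !))  ≡⟨ e (suc (n ∸ t)) (s !) ((t ∸ s) !) ((n ∸ t) !) ⟩
  s ! * ((t ∸ s) ! * (suc (n ∸ t) !))            ≡⟨ cong (λ m → s ! * ((t ∸ s) ! * m !)) (+-∸-assoc 1 (∣p∣≤n T)) ⟨
  s ! * ((t ∸ s) ! * (suc n ∸ t) !)              ∎
  where
  open ≡-Reasoning
  s = ∣ S ∣
  t = ∣ T ∣
  s≤t : s ≤ t
  s≤t = p⊆q⇒∣p∣≤∣q∣ (drop-∷-⊆ S⊆T)
  e : ∀ m a b c → m * (a * (b * c)) ≡ a * (b * (m * c))
  e = solve-∀
chainsThrough₂-! {suc n} (inside ∷ S) (inside ∷ T) S⊆T = begin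
  _ ≡⟨ ∑-split S T (_≤? ∣ S ∣) (_≤? ∣ T ∣) ⟩
  (∑[ j ∈ downFrom (suc n) ] 𝟙 ((j ≤? s) ×-dec (j ≤? t))) * chainsThrough₂ S T
    ≡⟨ cong₂ _*_ (trans (∑-cong (downFrom (suc n)) λ j → 𝟙-⇔ ((j ≤? s) ×-dec (j ≤? t)) ((0 ≤? j) ×-dec (j <? suc s))
                            (λ (j≤s , _) → z≤n , s≤s j≤s) (λ (_ , j<1+s) → ≤-pred j<1+s , ≤-trans (≤-pred j<1+s) s≤t))
                        (trans (∑-downFrom-interval (suc n) 0 (suc s)) (m≥n⇒m⊓n≡n (s≤s (∣p∣≤n S)))))
                 (chainsThrough₂-! S T (drop-∷-⊆ S⊆T)) ⟩
  suc s * (s ! * ((t ∸ s) ! * (n ∸ t) !))        ≡⟨ *-assoc (suc s) (s !) _ ⟨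
  (suc s) ! * ((t ∸ s) ! * (n ∸ t) !)            ∎
  where
  open ≡-Reasoning
  s = ∣ S ∣
  t = ∣ T ∣
  s≤t : s ≤ t
  s≤t = p⊆q⇒∣p∣≤∣q∣ (drop-∷-⊆ S⊆T)
chainsThrough₂-! {suc n} (outside ∷ S) (inside ∷ T) S⊆T = begin
  _ ≡⟨ ∑-split S T (∣ S ∣ ≤?_) (_≤? ∣ T ∣) ⟩
  (∑[ j ∈ downFrom (suc n) ] 𝟙 ((s ≤? j) ×-dec (j ≤? t))) * chainsThrough₂ S T
    ≡⟨ cong₂ _*_ (trans (∑-cong (downFrom (suc n)) λ j → 𝟙-⇔ ((s ≤? j) ×-dec (j ≤? t)) ((s ≤? j) ×-dec (j <? suc t))
                            (λ (s≤j , j≤t) → s≤j , s≤s j≤t) (λ (s≤j , j<1+t) → s≤j , ≤-pred j<1+t))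
                        (trans (∑-downFrom-interval (suc n) s (suc t)) (cong (_∸ s) (m≥n⇒m⊓n≡n (s≤s (∣p∣≤n T))))))
                 (chainsThrough₂-! S T (drop-∷-⊆ S⊆T)) ⟩
  (suc t ∸ s) * (s ! * ((t ∸ s) ! * (n ∸ t) !))  ≡⟨ cong (_* (s ! * ((t ∸ s) ! * (n ∸ t) !))) (+-∸-assoc 1 s≤t) ⟩
  suc (t ∸ s) * (s ! * ((t ∸ s) ! * (n ∸ t) !))  ≡⟨ e (suc (t ∸ s)) (s !) ((t ∸ s) !) ((n ∸ t) !) ⟩
  s ! * (suc (t ∸ s) ! * (n ∸ t) !)              ≡⟨ cong (λ m → s ! * (m ! * (n ∸ t) !)) (+-∸-assoc 1 s≤t) ⟨
  s ! * ((suc t ∸ s) ! * (n ∸ t) !)              ∎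
  where
  open ≡-Reasoning
  s = ∣ S ∣
  t = ∣ T ∣
  s≤t : s ≤ t
  s≤t = p⊆q⇒∣p∣≤∣q∣ (drop-∷-⊆ S⊆T)
  e : ∀ m a b c → m * (a * (b * c)) ≡ a * (m * b * c)
  e = solve-∀

-- Lists without repetition and the size of a union of copies.

length-cartesianProductWith : {D : Set} (f : A → B → D) (xs : List A) (ys : List B) →
  length (cartesianProductWith f xs ys) ≡ length xs * length ys
length-cartesianProductWith f []       ys = refl
length-cartesianProductWith f (x ∷ xs) ys = trans (length-++ (map (f x) ys))
  (cong₂ _+_ (length-map (f x) ys) (length-cartesianProductWith f xs ys))

AllPairs-lookup : {R : A → A → Set} → (∀ {x y} → R x y → R y x) →
  {xs : List A} → AllPairs R xs → ∀ {i j} → i ≢ j → R (lookup xs i) (lookup xs j)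
AllPairs-lookup sym-R (Rx ∷ Rxs) {Fin.zero}  {Fin.zero}  i≢j = contradiction refl i≢j
AllPairs-lookup sym-R (Rx ∷ Rxs) {Fin.zero}  {Fin.suc j} i≢j = All.lookup Rx (∈-lookup j)
AllPairs-lookup sym-R (Rx ∷ Rxs) {Fin.suc i} {Fin.zero}  i≢j = sym-R (All.lookup Rx (∈-lookup i))
AllPairs-lookup sym-R (Rx ∷ Rxs) {Fin.suc i} {Fin.suc j} i≢j = AllPairs-lookup sym-R Rxs (i≢j ∘ cong Fin.suc)

-- Sending a position in xs to the position of the same element in ys is injective, as xs has no
-- repetition.
Unique-⊆⇒length≤ : {xs ys : List A} → Unique xs → (∀ {x} → x ∈ xs → x ∈ ys) → length xs ≤ length ys
Unique-⊆⇒length≤ {A = A} {xs} {ys} xs! xs⊆ys = injective⇒≤ {f = λ i → Any.index (xs⊆ys (∈-lookup {xs = xs} i))} inj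
  where
  inj : ∀ {i j} → Any.index (xs⊆ys (∈-lookup {xs = xs} i)) ≡ Any.index (xs⊆ys (∈-lookup {xs = xs} j)) → i ≡ j
  inj {i} {j} eq with i ≟ᶠ j
  ... | yes i≡j = i≡j
  ... | no  i≢j = contradiction (index-injective (setoid A) (xs⊆ys (∈-lookup i)) (xs⊆ys (∈-lookup j)) eq)
                                (AllPairs-lookup (_∘ sym) xs! i≢j)

allSubsets-complete : ∀ {n} (S : Subset n) → S ∈ allSubsets n
allSubsets-complete []            = here refl
allSubsets-complete (outside ∷ S) = ∈-++⁺ˡ (∈-map⁺ (outside ∷_) (allSubsets-complete S))
allSubsets-complete {suc n} (inside ∷ S) =
  ∈-++⁺ʳ (map (outside ∷_) (allSubsets n)) (∈-map⁺ (inside ∷_) (allSubsets-complete S))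

allSubsets-unique : ∀ n → Unique (allSubsets n)
allSubsets-unique zero    = [] ∷ []
allSubsets-unique (suc n) = Unique.++⁺ (Unique.map⁺ ∷-injectiveʳ (allSubsets-unique n))
                                       (Unique.map⁺ ∷-injectiveʳ (allSubsets-unique n))
                                       disjoint
  where
  disjoint : ∀ {S} → ¬ (S ∈ map (outside ∷_) (allSubsets n) × S ∈ map (inside ∷_) (allSubsets n))
  disjoint (S∈out , S∈in) with ∈-map⁻ (outside ∷_) S∈out | ∈-map⁻ (inside ∷_) S∈in
  ... | _ , _ , refl | _ , _ , ()

module _ {p n t : ℕ} (F : Fin t → Fin p → Subset n) where

  private
    InUnion? : (S : Subset n) → Dec (InUnion F S)
    InUnion? S = any? (λ i → any? (λ a → ≡-dec _≟ᵇ_ (F i a) S))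

    members : List (Subset n)
    members = cartesianProductWith F (allFin t) (allFin p)

    length-members : length members ≡ t * p
    length-members = trans (length-cartesianProductWith F (allFin t) (allFin p))
                           (cong₂ _*_ (length-tabulate {n = t} id) (length-tabulate {n = p} id))

  unionSize≤ : unionSize F ≤ t * p
  unionSize≤ = subst (unionSize F ≤_) length-members
    (Unique-⊆⇒length≤ (Unique.filter⁺ InUnion? (allSubsets-unique n)) λ S∈ →
      let (i , a , Fia≡S) = proj₂ (∈-filter⁻ InUnion? {xs = allSubsets n} S∈)
      in subst (_∈ members) Fia≡S (∈-cartesianProductWith⁺ F (∈-allFin i) (∈-allFin a)))

  unionSize≥ : (∀ {i j a b} → F i a ≡ F j b → i ≡ j × a ≡ b) → t * p ≤ unionSize F
  unionSize≥ F-inj = subst (_≤ unionSize F) length-members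
    (Unique-⊆⇒length≤ (Unique.cartesianProductWith⁺ F F-inj (Unique.allFin⁺ t) (Unique.allFin⁺ p)) λ {S} S∈ →
      let (i , a , _ , _ , S≡Fia) = ∈-cartesianProductWith⁻ F (allFin t) (allFin p) S∈
      in ∈-filter⁺ InUnion? (allSubsets-complete S) (i , a , sym S≡Fia))

-- Upper bound: chains that meet the closures of unrelated copies.

∑-mono-All : {xs : List A} {f g : A → ℕ} → All (λ x → f x ≤ g x) xs → ∑ xs f ≤ ∑ xs g
∑-mono-All []         = z≤n
∑-mono-All (le ∷ les) = +-mono-≤ le (∑-mono-All les)

∑-exclusive : {P : A → Set} (P? : ∀ x → Dec (P x)) → (∀ {x y} → P x → P y → x ≡ y) →
  {xs : List A} → Unique xs → ∑[ x ∈ xs ] 𝟙 (P? x) ≤ 1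
∑-exclusive P? P-unique [] = z≤n
∑-exclusive P? P-unique {x ∷ xs} (x∉xs ∷ xs!) with P? x
... | no  _  = ∑-exclusive P? P-unique xs!
... | yes px = ≤-reflexive (cong suc (none x∉xs))
  where
  none : ∀ {ys} → All (x ≢_) ys → ∑[ y ∈ ys ] 𝟙 (P? y) ≡ 0
  none []           = refl
  none (x≢y ∷ x∉ys) = cong₂ _+_ (𝟙-no (P? _) (x≢y ∘ P-unique px)) (none x∉ys)

suc-!*suc-!≤ : ∀ u v → suc u ! * suc v ! ≤ suc (u + v) !
suc-!*suc-!≤ u zero = ≤-reflexive (trans (*-identityʳ (suc u !)) (cong (λ m → suc m !) (sym (+-identityʳ u))))
suc-!*suc-!≤ u (suc v) = begin
  suc u ! * (suc (suc v) * suc v !)        ≡⟨ e (suc u !) (suc (suc v)) (suc v !) ⟩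
  suc (suc v) * (suc u ! * suc v !)        ≤⟨ *-mono-≤ (s≤s (s≤s (m≤n+m v u))) (suc-!*suc-!≤ u v) ⟩
  suc (suc (u + v)) * suc (u + v) !        ≡⟨ cong (λ m → suc m !) (+-suc u v) ⟨
  suc (u + suc v) !                        ∎
  where open ≤-Reasoning
        e : ∀ a b c → a * (b * c) ≡ b * (a * c)
        e = solve-∀

-- For positive u and v already u! v! ≤ (u + v - 1)!, which leaves the factor u + v ≥ k to spare.
*!*!≤+! : ∀ k u v → 1 ≤ u → 1 ≤ v → k ≤ v → k * (u ! * v !) ≤ (u + v) !
*!*!≤+! k (suc u) (suc v) _ _ k≤v = begin
  k * (suc u ! * suc v !)                ≤⟨ *-mono-≤ (m≤n⇒m≤o+n (suc u) k≤v) (suc-!*suc-!≤ u v) ⟩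
  (suc u + suc v) * suc (u + v) !        ≡⟨ cong (λ m → suc m * suc (u + v) !) (+-suc u v) ⟩
  suc (suc (u + v)) !                    ≡⟨ cong (λ m → suc m !) (+-suc u v) ⟨
  (suc u + suc v) !                      ∎
  where open ≤-Reasoning

module _ {n : ℕ} where

  chainsThrough-! : (S : Subset n) → chainsThrough S ≡ ∣ S ∣ ! * (n ∸ ∣ S ∣) !
  chainsThrough-! S = begin
    chainsThrough S                                    ≡⟨ ∑-cong (allChains n) (λ γ → square (S ∈ᶜ? γ)) ⟩
    chainsThrough₂ S S                                 ≡⟨ chainsThrough₂-! S S ⊆-refl ⟩
    ∣ S ∣ ! * ((∣ S ∣ ∸ ∣ S ∣) ! * (n ∸ ∣ S ∣) !)      ≡⟨ cong (λ m → ∣ S ∣ ! * (m ! * (n ∸ ∣ S ∣) !)) (n∸n≡0 ∣ S ∣) ⟩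
    ∣ S ∣ ! * (1 * (n ∸ ∣ S ∣) !)                      ≡⟨ cong (∣ S ∣ ! *_) (*-identityˡ _) ⟩
    ∣ S ∣ ! * (n ∸ ∣ S ∣) !                            ∎
    where
    open ≡-Reasoning
    square : {P : Set} (d : Dec P) → 𝟙 d ≡ 𝟙 d * 𝟙 d
    square (yes _) = refl
    square (no  _) = refl

  C*chainsThrough : (S : Subset n) → (n C ∣ S ∣) * chainsThrough S ≡ n !
  C*chainsThrough S = trans (cong ((n C ∣ S ∣) *_) (chainsThrough-! S)) (C-! (∣p∣≤n S))

  !≤central*chainsThrough : (S : Subset n) → n ! ≤ (n C (n / 2)) * chainsThrough S
  !≤central*chainsThrough S = subst (_≤ (n C (n / 2)) * chainsThrough S) (C*chainsThrough S)
    (*-monoˡ-≤ (chainsThrough S) (C≤central n ∣ S ∣))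

  -- The factor s! is common to both counts. The rest is compared by `*!*!≤+!`, as T lies strictly
  -- above S and at least k levels below the top.
  *chainsThrough₂≤ : ∀ k (S T : Subset n) → 1 ≤ k → S ⊆ T → S ≢ T → ∣ T ∣ + k ≤ n →
    k * chainsThrough₂ S T ≤ chainsThrough S
  *chainsThrough₂≤ k S T 1≤k S⊆T S≢T t+k≤n = begin
    k * chainsThrough₂ S T                    ≡⟨ cong (k *_) (chainsThrough₂-! S T S⊆T) ⟩
    k * (s ! * ((t ∸ s) ! * (n ∸ t) !))       ≡⟨ e k (s !) _ ⟩
    s ! * (k * ((t ∸ s) ! * (n ∸ t) !))       ≤⟨ *-monoʳ-≤ (s !) (*!*!≤+! k (t ∸ s) (n ∸ t) (m<n⇒0<n∸m s<t) (≤-trans 1≤k k≤n∸t) k≤n∸t) ⟩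
    s ! * ((t ∸ s) + (n ∸ t)) !               ≡⟨ cong (λ m → s ! * m !) t∸s+n∸t ⟩
    s ! * (n ∸ s) !                           ≡⟨ chainsThrough-! S ⟨
    chainsThrough S                           ∎
    where
    open ≤-Reasoning
    s = ∣ S ∣
    t = ∣ T ∣
    e : ∀ a b c → a * (b * c) ≡ b * (a * c)
    e = solve-∀
    s<t : s < t
    s<t = ≰⇒> (S≢T ∘ ⊆∧∣≥∣⇒≡ S⊆T)
    k≤n∸t : k ≤ n ∸ t
    k≤n∸t = m+n≤o⇒m≤o∸n k (subst (_≤ n) (+-comm t k) t+k≤n)
    t∸s+n∸t : (t ∸ s) + (n ∸ t) ≡ n ∸ s
    t∸s+n∸t = trans (+-comm (t ∸ s) (n ∸ t)) (trans (sym (+-∸-assoc (n ∸ t) (<⇒≤ s<t))) (cong (_∸ s) (m∸n+n≡m (∣p∣≤n T))))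

  -- The symmetric form, usable without knowing which of the sets is the larger one; no chain
  -- contains two incomparable sets.
  *chainsThrough₂≤+ : ∀ k (S T : Subset n) → 1 ≤ k → S ≢ T → ∣ S ∣ + k ≤ n → ∣ T ∣ + k ≤ n →
    k * chainsThrough₂ S T ≤ chainsThrough S + chainsThrough T
  *chainsThrough₂≤+ k S T 1≤k S≢T s+k≤n t+k≤n with S ⊆? T | T ⊆? S
  ... | yes S⊆T | _       = m≤n⇒m≤n+o _ (*chainsThrough₂≤ k S T 1≤k S⊆T S≢T t+k≤n)
  ... | no  _   | yes T⊆S = m≤n⇒m≤o+n _ (subst (λ m → k * m ≤ chainsThrough T)
        (∑-cong (allChains n) (λ γ → *-comm (𝟙 (T ∈ᶜ? γ)) (𝟙 (S ∈ᶜ? γ))))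
        (*chainsThrough₂≤ k T S 1≤k T⊆S (S≢T ∘ sym) s+k≤n))
  ... | no  S⊈T | no  T⊈S = ≤-trans (≤-reflexive (trans (cong (k *_) none) (*-zeroʳ k))) z≤n
    where
    never : ∀ γ → 𝟙 (S ∈ᶜ? γ) * 𝟙 (T ∈ᶜ? γ) ≡ 0
    never γ with S ∈ᶜ? γ | T ∈ᶜ? γ
    ... | no  _   | _       = refl
    ... | yes _   | no  _   = refl
    ... | yes S∈γ | yes T∈γ with chain-total S T γ S∈γ T∈γ
    ...   | inj₁ S⊆T = ⊥-elim (S⊈T S⊆T)
    ...   | inj₂ T⊆S = ⊥-elim (T⊈S T⊆S)
    none : chainsThrough₂ S T ≡ 0
    none = trans (∑-cong (allChains n) never) (trans (∑-const (allChains n) 0) (*-zeroʳ (length (allChains n))))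

  Hits : List (Subset n) → Chain n → Set
  Hits X γ = Any (_∈ᶜ γ) X

  hits? : ∀ X γ → Dec (Hits X γ)
  hits? X γ = Any.any? (_∈ᶜ? γ) X

  #hits : List (Subset n) → ℕ
  #hits X = ∑[ γ ∈ allChains n ] 𝟙 (hits? X γ)

  #hits-mono : ∀ {X Y} → All (_∈ Y) X → #hits X ≤ #hits Y
  #hits-mono {X} {Y} X⊆Y = ∑-mono (allChains n) pointwise
    where
    pointwise : ∀ γ → 𝟙 (hits? X γ) ≤ 𝟙 (hits? Y γ)
    pointwise γ with hits? X γ
    ... | no  _   = z≤n
    ... | yes hit = let (_ , S∈X , S∈γ) = find hit
                    in ≤-reflexive (sym (𝟙-yes (hits? Y γ) (lose (All.lookup X⊆Y S∈X) S∈γ)))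

  hits≤∑ : ∀ X γ → 𝟙 (hits? X γ) ≤ ∑[ T ∈ X ] 𝟙 (T ∈ᶜ? γ)
  hits≤∑ []      γ = z≤n
  hits≤∑ (T ∷ X) γ with T ∈ᶜ? γ
  ... | yes _ = s≤s z≤n
  ... | no  _ = hits≤∑ X γ

  -- A chain that is counted twice on the left passes through S and through some member of X, and so
  -- is counted in the last sum as well.
  #hits-∷ : ∀ S X → chainsThrough S + #hits X ≤ #hits (S ∷ X) + ∑[ T ∈ X ] chainsThrough₂ S T
  #hits-∷ S X = begin
    chainsThrough S + #hits X
      ≡⟨ ∑-+ (allChains n) (λ γ → 𝟙 (S ∈ᶜ? γ)) (λ γ → 𝟙 (hits? X γ)) ⟨
    ∑[ γ ∈ allChains n ] (𝟙 (S ∈ᶜ? γ) + 𝟙 (hits? X γ))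
      ≤⟨ ∑-mono (allChains n) pointwise ⟩
    ∑[ γ ∈ allChains n ] (𝟙 (hits? (S ∷ X) γ) + ∑[ T ∈ X ] 𝟙 (S ∈ᶜ? γ) * 𝟙 (T ∈ᶜ? γ))
      ≡⟨ ∑-+ (allChains n) _ _ ⟩
    #hits (S ∷ X) + ∑[ γ ∈ allChains n ] ∑[ T ∈ X ] 𝟙 (S ∈ᶜ? γ) * 𝟙 (T ∈ᶜ? γ)
      ≡⟨ cong (#hits (S ∷ X) +_) (∑-swap (allChains n) X (λ γ T → 𝟙 (S ∈ᶜ? γ) * 𝟙 (T ∈ᶜ? γ))) ⟩
    #hits (S ∷ X) + ∑[ T ∈ X ] chainsThrough₂ S T ∎
    where
    open ≤-Reasoning
    pointwise : ∀ γ → 𝟙 (S ∈ᶜ? γ) + 𝟙 (hits? X γ) ≤ 𝟙 (hits? (S ∷ X) γ) + ∑[ T ∈ X ] 𝟙 (S ∈ᶜ? γ) * 𝟙 (T ∈ᶜ? γ)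
    pointwise γ with S ∈ᶜ? γ
    ... | no  _ = m≤m+n _ _
    ... | yes _ = s≤s (≤-trans (hits≤∑ X γ) (≤-reflexive (∑-cong X (λ T → sym (*-identityˡ (𝟙 (T ∈ᶜ? γ)))))))

  -- Bonferroni: the pairs of members met by a common chain cost at most the second summand.
  *∑chainsThrough≤ : ∀ k X → 1 ≤ k → Unique X → All (λ S → ∣ S ∣ + k ≤ n) X →
    k * ∑ X chainsThrough ≤ k * #hits X + length X * ∑ X chainsThrough
  *∑chainsThrough≤ k []      1≤k []           []            = ≤-trans (≤-reflexive (*-zeroʳ k)) z≤n
  *∑chainsThrough≤ k (S ∷ X) 1≤k (S∉X ∷ X!) (S-low ∷ X-low) = begin
    k * (N + Σ)                                    ≡⟨ *-distribˡ-+ k N Σ ⟩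
    k * N + k * Σ                                  ≤⟨ +-monoʳ-≤ (k * N) (*∑chainsThrough≤ k X 1≤k X! X-low) ⟩
    k * N + (k * #hits X + ℓ * Σ)                  ≡⟨ e₁ k N (#hits X) (ℓ * Σ) ⟩
    k * (N + #hits X) + ℓ * Σ                      ≤⟨ +-monoˡ-≤ (ℓ * Σ) (*-monoʳ-≤ k (#hits-∷ S X)) ⟩
    k * (#hits (S ∷ X) + Σ₂) + ℓ * Σ               ≡⟨ cong (_+ ℓ * Σ) (*-distribˡ-+ k (#hits (S ∷ X)) Σ₂) ⟩
    k * #hits (S ∷ X) + k * Σ₂ + ℓ * Σ             ≤⟨ +-monoˡ-≤ (ℓ * Σ) (+-monoʳ-≤ (k * #hits (S ∷ X)) kΣ₂≤) ⟩
    k * #hits (S ∷ X) + (ℓ * N + Σ) + ℓ * Σ        ≤⟨ m≤n+m _ N ⟩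
    N + (k * #hits (S ∷ X) + (ℓ * N + Σ) + ℓ * Σ)  ≡⟨ e₂ N (k * #hits (S ∷ X)) ℓ Σ ⟩
    k * #hits (S ∷ X) + suc ℓ * (N + Σ)            ∎
    where
    open ≤-Reasoning
    ℓ = length X
    N = chainsThrough S
    Σ = ∑ X chainsThrough
    Σ₂ = ∑[ T ∈ X ] chainsThrough₂ S T
    e₁ : ∀ k a b c → k * a + (k * b + c) ≡ k * (a + b) + c
    e₁ = solve-∀
    e₂ : ∀ a b l s → a + (b + (l * a + s) + l * s) ≡ b + (a + s + l * (a + s))
    e₂ = solve-∀
    kΣ₂≤ : k * Σ₂ ≤ ℓ * N + Σ
    kΣ₂≤ = begin
      k * Σ₂                                       ≡⟨ ∑-*ˡ X k (chainsThrough₂ S) ⟨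
      ∑[ T ∈ X ] k * chainsThrough₂ S T            ≤⟨ ∑-mono-All (All.zipWith (λ {T} (S≢T , T-low) → *chainsThrough₂≤+ k S T 1≤k S≢T S-low T-low) (S∉X , X-low)) ⟩
      ∑[ T ∈ X ] (N + chainsThrough T)             ≡⟨ ∑-+ X (λ _ → N) chainsThrough ⟩
      (∑[ T ∈ X ] N) + Σ                           ≡⟨ cong (_+ Σ) (∑-const X N) ⟩
      ℓ * N + Σ                                    ∎

  -- The ratio of consecutive coefficients is (n - j) / (j + 1), and the hypothesis says that it is
  -- at least c.
  *C≤C-suc : ∀ c j → suc j * c + j ≤ n → c * (n C j) ≤ n C suc j
  *C≤C-suc c j le = *-cancelˡ-≤ (suc j) (begin
    suc j * (c * (n C j))   ≡⟨ *-assoc (suc j) c _ ⟨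
    suc j * c * (n C j)     ≤⟨ *-monoˡ-≤ (n C j) (m+n≤o⇒m≤o∸n (suc j * c) le) ⟩
    (n ∸ j) * (n C j)       ≡⟨ C-absorb n j ⟨
    suc j * (n C suc j)     ∎)
    where open ≤-Reasoning

  -- A layer fewer than k levels below the top is reflected to n - r < k; the layer just above that
  -- one is already at least c times as large.
  *C≤central : ∀ c k r → k * c + k ≤ n → r ≤ n → n < r + k → c * (n C r) ≤ n C (n / 2)
  *C≤central c k r kc+k≤n r≤n n<r+k = begin
    c * (n C r)         ≡⟨ cong (c *_) (nCk≡nC[n∸k] r≤n) ⟩
    c * (n C (n ∸ r))   ≤⟨ *C≤C-suc c (n ∸ r) (≤-trans (+-mono-≤ (*-monoˡ-≤ c n∸r<k) (<⇒≤ n∸r<k)) kc+k≤n) ⟩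
    n C suc (n ∸ r)     ≤⟨ C≤central n (suc (n ∸ r)) ⟩
    n C (n / 2)         ∎
    where
    open ≤-Reasoning
    n∸r<k : n ∸ r < k
    n∸r<k = +-cancelˡ-< r (n ∸ r) k (subst (_< r + k) (sym (m+[n∸m]≡n r≤n)) n<r+k)

  -- The distance from the top that separates the two cases is k = c + d. Among c members below it,
  -- pairs cost at most the share c / k of the chains, so d / (c + d) of c · n! / M remains. This
  -- share tends to 1 as d grows.
  #hits-lower : ∀ c d G → 1 ≤ c + d → (c + d) * c + (c + d) ≤ n → Unique G → c ≤ length G →
    c * d * n ! ≤ (c + d) * (n C (n / 2)) * #hits G
  #hits-lower c d G 1≤k large G! c≤G with all? (λ S → ∣ S ∣ + (c + d) ≤? n) G
  ... | no ¬low = begin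
    c * d * n !                                   ≡⟨ cong (c * d *_) (C*chainsThrough S) ⟨
    c * d * ((n C ∣ S ∣) * chainsThrough S)       ≡⟨ e c d (n C ∣ S ∣) (chainsThrough S) ⟩
    d * (c * (n C ∣ S ∣)) * chainsThrough S       ≤⟨ *-mono-≤ (*-mono-≤ (m≤n+m d c) (*C≤central c (c + d) ∣ S ∣ large (∣p∣≤n S) (≰⇒> S-high))) N≤ ⟩
    (c + d) * (n C (n / 2)) * #hits G             ∎
    where
    open ≤-Reasoning
    high = find (All.¬All⇒Any¬ (λ S → ∣ S ∣ + (c + d) ≤? n) G ¬low)
    S = proj₁ high
    S-high = proj₂ (proj₂ high)
    e : ∀ c d b t → c * d * (b * t) ≡ d * (c * b) * t
    e = solve-∀
    N≤ : chainsThrough S ≤ #hits G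
    N≤ = ≤-trans (∑-mono (allChains n) pointwise) (#hits-mono {X = S ∷ []} (proj₁ (proj₂ high) ∷ []))
      where
      pointwise : ∀ γ → 𝟙 (S ∈ᶜ? γ) ≤ 𝟙 (hits? (S ∷ []) γ)
      pointwise γ = ≤-reflexive (𝟙-⇔ (S ∈ᶜ? γ) (hits? (S ∷ []) γ) here λ { (here S∈γ) → S∈γ })
  ... | yes low = begin
    c * d * n !                         ≡⟨ e₁ c d (n !) ⟩
    d * (c * n !)                       ≤⟨ *-monoʳ-≤ d cn!≤ ⟩
    d * (M * Σ)                         ≡⟨ e₂ d M Σ ⟩
    M * (d * Σ)                         ≤⟨ *-monoʳ-≤ M dΣ≤ ⟩
    M * ((c + d) * #hits X)             ≤⟨ *-monoʳ-≤ M (*-monoʳ-≤ (c + d) (#hits-mono X⊆G)) ⟩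
    M * ((c + d) * #hits G)             ≡⟨ e₃ M (c + d) (#hits G) ⟩
    (c + d) * M * #hits G               ∎
    where
    open ≤-Reasoning
    M = n C (n / 2)
    -- The cost of pairs grows with the number of members, and the closure may have many more than
    -- c; exactly c of them are kept.
    X = take c G
    Σ = ∑ X chainsThrough
    X⊆G : All (_∈ G) X
    X⊆G = All.take⁺ c (All.tabulate id)
    length-X : length X ≡ c
    length-X = trans (length-take c G) (m≤n⇒m⊓n≡m c≤G)
    e₁ : ∀ c d x → c * d * x ≡ d * (c * x)
    e₁ = solve-∀
    e₂ : ∀ d m s → d * (m * s) ≡ m * (d * s)
    e₂ = solve-∀
    e₃ : ∀ m k h → m * (k * h) ≡ k * m * h
    e₃ = solve-∀
    cn!≤ : c * n ! ≤ M * Σ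
    cn!≤ = begin
      c * n !                          ≡⟨ cong (_* n !) length-X ⟨
      length X * n !                   ≡⟨ ∑-const X (n !) ⟨
      ∑[ S ∈ X ] n !                   ≤⟨ ∑-mono X !≤central*chainsThrough ⟩
      ∑[ S ∈ X ] M * chainsThrough S   ≡⟨ ∑-*ˡ X M chainsThrough ⟩
      M * Σ                            ∎
    dΣ≤ : d * Σ ≤ (c + d) * #hits X
    dΣ≤ = +-cancelˡ-≤ (c * Σ) _ _ (begin
      c * Σ + d * Σ                             ≡⟨ *-distribʳ-+ Σ c d ⟨
      (c + d) * Σ                               ≤⟨ *∑chainsThrough≤ (c + d) X 1≤k (Unique.take⁺ c G!) (All.take⁺ c low) ⟩
      (c + d) * #hits X + length X * Σ          ≡⟨ cong (λ l → (c + d) * #hits X + l * Σ) length-X ⟩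
      (c + d) * #hits X + c * Σ                 ≡⟨ +-comm _ (c * Σ) ⟩
      c * Σ + (c + d) * #hits X                 ∎)

module _ {p n : ℕ} (f : Fin p → Subset n) where

  InClosure? : (S : Subset n) → Dec (InClosure f S)
  InClosure? S = any? (λ a → any? (λ b → (f a ⊆? S) ×-dec (S ⊆? f b)))

  closure : List (Subset n)
  closure = filter InClosure? (allSubsets n)

module _ {p n t : ℕ} (F : Fin t → Fin p → Subset n) (unrelated : PairwiseUnrelated F) where

  -- Members S and T of two closures on one chain are comparable. If S ⊆ T, then some set of copy i
  -- lies below S and some set of copy j above T, against unrelatedness; likewise if T ⊆ S.
  hit-closures-exclusive : ∀ γ {i j} → Hits (closure (F i)) γ → Hits (closure (F j)) γ → i ≡ j
  hit-closures-exclusive γ {i} {j} hitᵢ hitⱼ with i ≟ᶠ j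
  ... | yes i≡j = i≡j
  ... | no  i≢j
    with S , S∈ , S∈γ ← find hitᵢ | T , T∈ , T∈γ ← find hitⱼ
    with a , a′ , a⊆S , S⊆a′ ← proj₂ (∈-filter⁻ (InClosure? (F i)) {xs = allSubsets n} S∈)
       | b , b′ , b⊆T , T⊆b′ ← proj₂ (∈-filter⁻ (InClosure? (F j)) {xs = allSubsets n} T∈)
    with chain-total S T γ S∈γ T∈γ
  ... | inj₁ S⊆T = ⊥-elim (proj₁ (unrelated i j i≢j a b′) (⊆-trans a⊆S (⊆-trans S⊆T T⊆b′)))
  ... | inj₂ T⊆S = ⊥-elim (proj₂ (unrelated i j i≢j a′ b) (⊆-trans b⊆T (⊆-trans T⊆S S⊆a′)))

  ∑#hits≤! : ∑[ i ∈ allFin t ] #hits (closure (F i)) ≤ n !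
  ∑#hits≤! = begin
    ∑[ i ∈ allFin t ] ∑[ γ ∈ allChains n ] 𝟙 (hits? (closure (F i)) γ)  ≡⟨ ∑-swap (allFin t) (allChains n) _ ⟩
    ∑[ γ ∈ allChains n ] ∑[ i ∈ allFin t ] 𝟙 (hits? (closure (F i)) γ)
      ≤⟨ ∑-mono (allChains n) (λ γ → ∑-exclusive (λ i → hits? (closure (F i)) γ) (hit-closures-exclusive γ) (Unique.allFin⁺ t)) ⟩
    ∑[ γ ∈ allChains n ] 1                                              ≡⟨ ∑-allChains-1 n ⟩
    n !                                                                 ∎
    where open ≤-Reasoning

  -- Counts pairs of a copy and a chain that meets its closure. For positive c and d the bound reads
  -- t ≤ (1/c + 1/d) M.
  #copies≤ : ∀ c d → 1 ≤ c + d → (c + d) * c + (c + d) ≤ n → (∀ i → c ≤ closureSize (F i)) →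
    t * (c * d) ≤ (c + d) * (n C (n / 2))
  #copies≤ c d 1≤k large c≤ = *-cancelʳ-≤ _ _ (n !) {{n !≢0}} (begin
    t * (c * d) * n !                                             ≡⟨ *-assoc t (c * d) (n !) ⟩
    t * (c * d * n !)                                             ≡⟨ cong (_* (c * d * n !)) (length-tabulate {n = t} id) ⟨
    length (allFin t) * (c * d * n !)                             ≡⟨ ∑-const (allFin t) (c * d * n !) ⟨
    ∑[ i ∈ allFin t ] c * d * n !                                 ≤⟨ ∑-mono (allFin t) (λ i → #hits-lower c d (closure (F i)) 1≤k large
                                                                       (Unique.filter⁺ (InClosure? (F i)) (allSubsets-unique n)) (c≤ i)) ⟩
    ∑[ i ∈ allFin t ] (c + d) * M * #hits (closure (F i))         ≡⟨ ∑-*ˡ (allFin t) ((c + d) * M) _ ⟩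
    (c + d) * M * (∑[ i ∈ allFin t ] #hits (closure (F i)))       ≤⟨ *-monoʳ-≤ ((c + d) * M) ∑#hits≤! ⟩
    (c + d) * M * n !                                             ∎)
    where open ≤-Reasoning
          M = n C (n / 2)

-- Lower bound: the recursive construction of unrelated copies.

∣++∣ : ∀ {k n} (S : Subset k) (T : Subset n) → ∣ S ++ᵛ T ∣ ≡ ∣ S ∣ + ∣ T ∣
∣++∣ []            T = refl
∣++∣ (outside ∷ S) T = ∣++∣ S T
∣++∣ (inside  ∷ S) T = cong suc (∣++∣ S T)

++-⊆⁺ : ∀ {k n} {S S′ : Subset k} {T T′ : Subset n} → S ⊆ S′ → T ⊆ T′ → S ++ᵛ T ⊆ S′ ++ᵛ T′
++-⊆⁺ {S = []}          {[]}           S⊆ T⊆ = T⊆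
++-⊆⁺ {S = outside ∷ S} {_ ∷ S′}       S⊆ T⊆ = out⊆ (++-⊆⁺ {S = S} (drop-∷-⊆ S⊆) T⊆)
++-⊆⁺ {S = inside  ∷ S} {outside ∷ S′} S⊆ T⊆ = in⊈out S⊆
++-⊆⁺ {S = inside  ∷ S} {inside  ∷ S′} S⊆ T⊆ = in⊆in (++-⊆⁺ {S = S} (drop-∷-⊆ S⊆) T⊆)

++-⊆⁻ˡ : ∀ {k n} (S S′ : Subset k) {T T′ : Subset n} → S ++ᵛ T ⊆ S′ ++ᵛ T′ → S ⊆ S′
++-⊆⁻ˡ []            []             le = id
++-⊆⁻ˡ (outside ∷ S) (_ ∷ S′)       le = out⊆ (++-⊆⁻ˡ S S′ (drop-∷-⊆ le))
++-⊆⁻ˡ (inside  ∷ S) (outside ∷ S′) le = in⊈out le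
++-⊆⁻ˡ (inside  ∷ S) (inside  ∷ S′) le = in⊆in (++-⊆⁻ˡ S S′ (drop-∷-⊆ le))

++-⊆⁻ʳ : ∀ {k n} (S S′ : Subset k) {T T′ : Subset n} → S ++ᵛ T ⊆ S′ ++ᵛ T′ → T ⊆ T′
++-⊆⁻ʳ []      []       le = le
++-⊆⁻ʳ (_ ∷ S) (_ ∷ S′) le = ++-⊆⁻ʳ S S′ (drop-∷-⊆ le)

length-filter-∑ : {P : A → Set} (P? : ∀ x → Dec (P x)) (xs : List A) →
  length (filter P? xs) ≡ ∑[ x ∈ xs ] 𝟙 (P? x)
length-filter-∑ P? []       = refl
length-filter-∑ P? (x ∷ xs) with P? x
... | yes _ = cong suc (length-filter-∑ P? xs)
... | no  _ = length-filter-∑ P? xs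

length-filter-¬ : {P : A → Set} (P? : ∀ x → Dec (P x)) (xs : List A) →
  length (filter (¬? ∘ P?) xs) + length (filter P? xs) ≡ length xs
length-filter-¬ P? []       = refl
length-filter-¬ P? (x ∷ xs) with P? x
... | yes _ = trans (+-suc _ _) (cong suc (length-filter-¬ P? xs))
... | no  _ = cong suc (length-filter-¬ P? xs)

length-allSubsets : ∀ n → length (allSubsets n) ≡ 2 ^ n
length-allSubsets zero    = refl
length-allSubsets (suc n) = begin
  length (map (outside ∷_) (allSubsets n) ++ map (inside ∷_) (allSubsets n))
    ≡⟨ length-++ (map (outside ∷_) (allSubsets n)) ⟩
  length (map (outside ∷_) (allSubsets n)) + length (map (inside ∷_) (allSubsets n))
    ≡⟨ cong₂ _+_ (trans (length-map (outside ∷_) (allSubsets n)) (length-allSubsets n))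
                 (trans (length-map (inside ∷_) (allSubsets n)) (length-allSubsets n)) ⟩
  2 ^ n + 2 ^ n   ≡⟨ cong (2 ^ n +_) (+-identityʳ (2 ^ n)) ⟨
  2 ^ suc n       ∎
  where open ≡-Reasoning

layer : ∀ n → ℕ → List (Subset n)
layer n r = filter (λ S → ∣ S ∣ ≟ r) (allSubsets n)

length-layer : ∀ n r → length (layer n r) ≡ n C r
length-layer n r = trans (length-filter-∑ (λ S → ∣ S ∣ ≟ r) (allSubsets n)) (∑-size n r)
  where
  open ≡-Reasoning
  ∑-size : ∀ n r → ∑[ S ∈ allSubsets n ] 𝟙 (∣ S ∣ ≟ r) ≡ n C r
  ∑-size zero    zero    = refl
  ∑-size zero    (suc r) = refl
  ∑-size (suc n) r = begin
    ∑[ S ∈ allSubsets (suc n) ] 𝟙 (∣ S ∣ ≟ r)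
      ≡⟨ ∑-++ (map (outside ∷_) (allSubsets n)) _ _ ⟩
    ∑[ S ∈ map (outside ∷_) (allSubsets n) ] 𝟙 (∣ S ∣ ≟ r) + ∑[ S ∈ map (inside ∷_) (allSubsets n) ] 𝟙 (∣ S ∣ ≟ r)
      ≡⟨ cong₂ _+_ (trans (∑-map (outside ∷_) (allSubsets n) _) (∑-size n r)) (∑-map (inside ∷_) (allSubsets n) _) ⟩
    n C r + ∑[ S ∈ allSubsets n ] 𝟙 (suc ∣ S ∣ ≟ r)
      ≡⟨ inside-part r ⟩
    suc n C r ∎
    where
    inside-part : ∀ r → n C r + ∑[ S ∈ allSubsets n ] 𝟙 (suc ∣ S ∣ ≟ r) ≡ suc n C r
    inside-part zero = trans (cong (n C 0 +_) (trans (∑-const (allSubsets n) 0) (*-zeroʳ (length (allSubsets n))))) refl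
    inside-part (suc r) = begin
      n C suc r + ∑[ S ∈ allSubsets n ] 𝟙 (suc ∣ S ∣ ≟ suc r)
        ≡⟨ cong (n C suc r +_) (∑-cong (allSubsets n) λ S → 𝟙-⇔ (suc ∣ S ∣ ≟ suc r) (∣ S ∣ ≟ r) suc-injective (cong suc)) ⟩
      n C suc r + ∑[ S ∈ allSubsets n ] 𝟙 (∣ S ∣ ≟ r)   ≡⟨ cong (n C suc r +_) (∑-size n r) ⟩
      n C suc r + n C r                                 ≡⟨ +-comm (n C suc r) (n C r) ⟩
      n C r + n C suc r                                 ≡⟨ nCk+nC[k+1]≡[n+1]C[k+1] n r ⟩
      suc n C suc r                                     ∎

Unrelated : ∀ {p n} → (Fin p → Subset n) → (Fin p → Subset n) → Set
Unrelated g h = ∀ a b → Incomparable (g a) (h b)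

Unrelated-sym : ∀ {p n} {g h : Fin p → Subset n} → Unrelated g h → Unrelated h g
Unrelated-sym u a b = proj₂ (u b a) , proj₁ (u b a)

-- A window for the sizes of all sets in a copy. Disjoint windows rule out inclusions from the
-- higher to the lower one.
Within : ∀ {p n} → ℕ → ℕ → (Fin p → Subset n) → Set
Within ℓ D g = ∀ a → ℓ ≤ ∣ g a ∣ × ∣ g a ∣ ≤ ℓ + D

module Packing {p k : ℕ} (_≼_ : Fin p → Fin p → Set) (f : Fin p → Subset k)
               (f-embeds : IsWeakEmbedding _≼_ f) where

  Above : Subset k → Set
  Above R = ∃ λ a → f a ⊆ R

  above? : ∀ R → Dec (Above R)
  above? R = any? (λ a → f a ⊆? R)

  -- The copies f a ++ T get the height k + 1.  A set R outside the closure can contain some f a or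
  -- be contained in one, but not both; its height lies on the side that blocks this inclusion.
  height : Subset k → ℕ
  height R = (k ∸ ∣ R ∣) + (if does (above? R) then 0 else 2 * suc k)

  -- The term k - |R| is at most k, and the penalty 2 (k + 1) alone exceeds k + 1. So heights avoid
  -- the value k + 1 on the side that `Above` decides.
  height-above : ∀ {R} → Above R → height R < suc k
  height-above {R} above with above? R
  ... | yes _  = s≤s (≤-trans (≤-reflexive (+-identityʳ _)) (m∸n≤m k ∣ R ∣))
  ... | no  ¬a = contradiction above ¬a

  height-¬above : ∀ {R} → ¬ Above R → suc k < height R
  height-¬above {R} ¬above with above? R
  ... | yes a = contradiction a ¬above
  ... | no  _ = m≤n⇒m≤o+n (k ∸ ∣ R ∣) (s≤s (≤-trans (m≤n+m (suc k) k) (+-monoʳ-≤ k (m≤m+n (suc k) 0))))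

  height≤ : ∀ R → height R ≤ k + 2 * suc k
  height≤ R with above? R
  ... | yes _ = +-mono-≤ (m∸n≤m k ∣ R ∣) z≤n
  ... | no  _ = +-monoˡ-≤ (2 * suc k) (m∸n≤m k ∣ R ∣)

  -- The term k - |R| decreases strictly and the penalty cannot increase, since `Above` passes to
  -- supersets. The smaller of two nested blocks thus gets the higher sizes in the rest, which
  -- blocks inclusion.
  height-antitone : ∀ {R R′} → R ⊆ R′ → R ≢ R′ → height R′ < height R
  height-antitone {R} {R′} R⊆R′ R≢R′ = +-mono-<-≤ (∸-monoʳ-< (≰⇒> (R≢R′ ∘ ⊆∧∣≥∣⇒≡ R⊆R′)) (∣p∣≤n R′)) penalty
    where
    penalty : (if does (above? R′) then 0 else 2 * suc k) ≤ (if does (above? R) then 0 else 2 * suc k)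
    penalty with above? R′ | above? R
    ... | yes _     | _             = z≤n
    ... | no  _     | no  _         = ≤-refl
    ... | no ¬above | yes (a , a⊆R) = ⊥-elim (¬above (a , ⊆-trans a⊆R R⊆R′))

  outer : List (Subset k)
  outer = filter (¬? ∘ InClosure? f) (allSubsets k)

  length-outer : length outer + closureSize f ≡ 2 ^ k
  length-outer = trans (length-filter-¬ (InClosure? f) (allSubsets k)) (length-allSubsets k)

  outer-∉ : All (λ R → ¬ InClosure f R) outer
  outer-∉ = All.all-filter (¬? ∘ InClosure? f) (allSubsets k)

  -- A bound for the spread of sizes after J rounds: at most k from the block, then the largest
  -- shift, at height k + 2 (k + 1), then the spread of the inner family.
  width : ℕ → ℕ
  width zero    = 0
  width (suc J) = k + (suc (width J) * (k + 2 * suc k) + width J)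

  dim : ℕ → ℕ → ℕ
  dim zero    n = n
  dim (suc J) n = k + dim J n

  dim≡ : ∀ J n → dim J n ≡ dim J 0 + n
  dim≡ zero    n = refl
  dim≡ (suc J) n = trans (cong (k +_) (dim≡ J n)) (sym (+-assoc k (dim J 0) n))

  -- One unit of height is worth `suc (width J)` levels, one more than the spread of an inner
  -- family, so that different heights use disjoint ranges of sizes.
  level : ℕ → ℕ → ℕ → ℕ
  level J ℓ h = ℓ + suc (width J) * h

  _⊕_ : ∀ {n} → Subset k → (Fin p → Subset n) → Fin p → Subset (k + n)
  (R ⊕ g) a = R ++ᵛ g a

  f-on : ∀ {n} → Subset n → Fin p → Subset (k + n)
  f-on T a = f a ++ᵛ T

  module _ (n₀ : ℕ) where

    -- Here ℓ is the base size: all sets of the family have sizes from ℓ to ℓ + `width J`. Zero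
    -- rounds give no copies; the room this leaves empty is the term with `b ^ J` in
    -- `family-density`.
    family : ∀ J → ℕ → List (Fin p → Subset (dim J n₀))
    family zero    ℓ = []
    family (suc J) ℓ = map f-on (layer (dim J n₀) (level J ℓ (suc k)))
                    ++ concat (map (λ R → map (R ⊕_) (family J (level J ℓ (height R)))) outer)

    length-family-suc : ∀ J ℓ → length (family (suc J) ℓ) ≡
      (dim J n₀ C level J ℓ (suc k)) + ∑[ R ∈ outer ] length (family J (level J ℓ (height R)))
    length-family-suc J ℓ = trans (length-++ (map f-on (layer (dim J n₀) (level J ℓ (suc k)))))
      (cong₂ _+_ (trans (length-map f-on (layer (dim J n₀) (level J ℓ (suc k)))) (length-layer (dim J n₀) (level J ℓ (suc k))))
                 (length-concat outer))
      where
      length-concat : ∀ Rs → length (concat (map (λ R → map (R ⊕_) (family J (level J ℓ (height R)))) Rs))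
                           ≡ ∑[ R ∈ Rs ] length (family J (level J ℓ (height R)))
      length-concat []       = refl
      length-concat (R ∷ Rs) = trans (length-++ (map (R ⊕_) (family J (level J ℓ (height R)))))
        (cong₂ _+_ (length-map (R ⊕_) (family J (level J ℓ (height R)))) (length-concat Rs))

    all-family-suc : ∀ J ℓ {Q : (Fin p → Subset (dim (suc J) n₀)) → Set} →
      (∀ {T} → ∣ T ∣ ≡ level J ℓ (suc k) → Q (f-on T)) →
      All (λ R → All (Q ∘ (R ⊕_)) (family J (level J ℓ (height R)))) outer →
      All Q (family (suc J) ℓ)
    all-family-suc J ℓ Q-f Q-R = All.++⁺
      (All.map⁺ (All.map Q-f (All.all-filter (λ S → ∣ S ∣ ≟ level J ℓ (suc k)) (allSubsets (dim J n₀)))))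
      (All.concat⁺ (All.map⁺ (All.map All.map⁺ Q-R)))

    family-embeds : ∀ J ℓ → All (IsWeakEmbedding _≼_) (family J ℓ)
    family-embeds zero    ℓ = []
    family-embeds (suc J) ℓ = all-family-suc J ℓ (λ _ → f-on-embeds)
      (All.universal (λ R → All.map ⊕-embeds (family-embeds J (level J ℓ (height R)))) outer)
      where
      f-on-embeds : ∀ {n} {T : Subset n} → IsWeakEmbedding _≼_ (f-on T)
      f-on-embeds = (λ a b eq → proj₁ f-embeds a b (++-injectiveˡ (f a) (f b) eq)) ,
                    (λ a b a≼b a≢b → let (⊆ , ≢) = proj₂ f-embeds a b a≼b a≢b
                                     in ++-⊆⁺ {S = f a} ⊆ ⊆-refl , ≢ ∘ ++-injectiveˡ (f a) (f b))
      ⊕-embeds : ∀ {n R} {g : Fin p → Subset n} → IsWeakEmbedding _≼_ g → IsWeakEmbedding _≼_ (R ⊕ g)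
      ⊕-embeds {R = R} g-embeds =
        (λ a b eq → proj₁ g-embeds a b (++-injectiveʳ R R eq)) ,
        (λ a b a≼b a≢b → let (⊆ , ≢) = proj₂ g-embeds a b a≼b a≢b
                         in ++-⊆⁺ {S = R} ⊆-refl ⊆ , ≢ ∘ ++-injectiveʳ R R)

    family-within : ∀ J ℓ → All (Within ℓ (width J)) (family J ℓ)
    family-within zero    ℓ = []
    family-within (suc J) ℓ = all-family-suc J ℓ f-on-within
      (All.universal (λ R → All.map (⊕-within R) (family-within J (level J ℓ (height R)))) outer)
      where
      open ≤-Reasoning
      D = width J
      e : ∀ a b u v → a + (b + u + v) ≡ b + (a + (u + v))
      e = solve-∀
      f-on-within : ∀ {T} → ∣ T ∣ ≡ level J ℓ (suc k) → Within ℓ (width (suc J)) (f-on T)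
      f-on-within {T} T-size a = (begin
        ℓ                               ≤⟨ m≤m+n ℓ _ ⟩
        level J ℓ (suc k)               ≡⟨ T-size ⟨
        ∣ T ∣                           ≤⟨ m≤n+m ∣ T ∣ ∣ f a ∣ ⟩
        ∣ f a ∣ + ∣ T ∣                 ≡⟨ ∣++∣ (f a) T ⟨
        ∣ f a ++ᵛ T ∣                   ∎) , (begin
        ∣ f a ++ᵛ T ∣                                   ≡⟨ ∣++∣ (f a) T ⟩
        ∣ f a ∣ + ∣ T ∣                                 ≡⟨ cong (∣ f a ∣ +_) T-size ⟩
        ∣ f a ∣ + level J ℓ (suc k)                     ≤⟨ +-mono-≤ (∣p∣≤n (f a)) (+-monoʳ-≤ ℓ (*-monoʳ-≤ (suc D) (≤-trans (m≤m+n (suc k) _) (m≤n+m (2 * suc k) k)))) ⟩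
        k + level J ℓ (k + 2 * suc k)                   ≤⟨ +-monoʳ-≤ k (m≤m+n _ D) ⟩
        k + (level J ℓ (k + 2 * suc k) + D)             ≡⟨ e k ℓ (suc D * (k + 2 * suc k)) D ⟩
        ℓ + width (suc J)                               ∎)
      ⊕-within : ∀ R {g} → Within (level J ℓ (height R)) D g → Within ℓ (width (suc J)) (R ⊕ g)
      ⊕-within R {g} g-within a = (begin
        ℓ                               ≤⟨ m≤m+n ℓ _ ⟩
        level J ℓ (height R)            ≤⟨ proj₁ (g-within a) ⟩
        ∣ g a ∣                         ≤⟨ m≤n+m ∣ g a ∣ ∣ R ∣ ⟩
        ∣ R ∣ + ∣ g a ∣                 ≡⟨ ∣++∣ R (g a) ⟨
        ∣ R ++ᵛ g a ∣                   ∎) , (begin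
        ∣ R ++ᵛ g a ∣                                   ≡⟨ ∣++∣ R (g a) ⟩
        ∣ R ∣ + ∣ g a ∣                                 ≤⟨ +-mono-≤ (∣p∣≤n R) (proj₂ (g-within a)) ⟩
        k + (level J ℓ (height R) + D)                  ≤⟨ +-monoʳ-≤ k (+-monoˡ-≤ D (+-monoʳ-≤ ℓ (*-monoʳ-≤ (suc D) (height≤ R)))) ⟩
        k + (level J ℓ (k + 2 * suc k) + D)             ≡⟨ e k ℓ (suc D * (k + 2 * suc k)) D ⟩
        ℓ + width (suc J)                               ∎)

    private
      level-gap : ∀ J ℓ {h h′} → h < h′ → level J ℓ h + width J < level J ℓ h′
      level-gap J ℓ {h} {h′} h<h′ = begin-strict
        ℓ + suc D * h + D        <⟨ n<1+n _ ⟩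
        suc (ℓ + suc D * h + D)  ≡⟨ e ℓ D h ⟩
        ℓ + suc D * suc h        ≤⟨ +-monoʳ-≤ ℓ (*-monoʳ-≤ (suc D) h<h′) ⟩
        ℓ + suc D * h′           ∎
        where
        open ≤-Reasoning
        D = width J
        e : ∀ ℓ D h → suc (ℓ + suc D * h + D) ≡ ℓ + suc D * suc h
        e = solve-∀

      f-on-unrelated : ∀ {n r} {T T′ : Subset n} → ∣ T ∣ ≡ r → ∣ T′ ∣ ≡ r → T ≢ T′ → Unrelated (f-on T) (f-on T′)
      f-on-unrelated {T = T} {T′} refl T′-size T≢T′ a b =
        (λ le → T≢T′ (⊆∧∣≥∣⇒≡ (++-⊆⁻ʳ (f a) (f b) le) (≤-reflexive T′-size))) ,
        (λ le → T≢T′ (sym (⊆∧∣≥∣⇒≡ (++-⊆⁻ʳ (f b) (f a) le) (≤-reflexive (sym T′-size)))))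

      -- An inclusion between the concatenated sets gives one on the block, which decides the height
      -- of R, and one on the rest, which the sizes then contradict.
      f-on-⊕-unrelated : ∀ J ℓ {R} {T : Subset (dim J n₀)} {g} → ∣ T ∣ ≡ level J ℓ (suc k) →
        ¬ InClosure f R → Within (level J ℓ (height R)) (width J) g → Unrelated (f-on T) (R ⊕ g)
      f-on-⊕-unrelated J ℓ {R} {T} {g} T-size R∉ g-within a b = below , above
        where
        open ≤-Reasoning
        below : ¬ (f a ++ᵛ T ⊆ R ++ᵛ g b)
        below le = n≮n ∣ T ∣ (begin-strict
          ∣ T ∣                           ≤⟨ p⊆q⇒∣p∣≤∣q∣ (++-⊆⁻ʳ (f a) R le) ⟩
          ∣ g b ∣                         ≤⟨ proj₂ (g-within b) ⟩
          level J ℓ (height R) + width J  <⟨ level-gap J ℓ (height-above (a , ++-⊆⁻ˡ (f a) R le)) ⟩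
          level J ℓ (suc k)               ≡⟨ T-size ⟨
          ∣ T ∣                           ∎)
        above : ¬ (R ++ᵛ g b ⊆ f a ++ᵛ T)
        above le = n≮n ∣ T ∣ (begin-strict
          ∣ T ∣                           ≡⟨ T-size ⟩
          level J ℓ (suc k)               ≤⟨ m≤m+n _ _ ⟩
          -- Now R ⊆ f a. If some f a′ were contained in R as well, R would belong to the closure;
          -- so R is not above and has the larger height.
          level J ℓ (suc k) + width J     <⟨ level-gap J ℓ (height-¬above λ (a′ , a′⊆R) → R∉ (a′ , a , a′⊆R , ++-⊆⁻ˡ R (f a) le)) ⟩
          level J ℓ (height R)            ≤⟨ proj₁ (g-within b) ⟩
          ∣ g b ∣                         ≤⟨ p⊆q⇒∣p∣≤∣q∣ (++-⊆⁻ʳ R (f a) le) ⟩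
          ∣ T ∣                           ∎)

      ⊕-⊈ : ∀ J ℓ {R R′} (g g′ : Fin p → Subset (dim J n₀)) → R ≢ R′ →
        Within (level J ℓ (height R)) (width J) g → Within (level J ℓ (height R′)) (width J) g′ →
        ∀ a b → ¬ ((R ⊕ g) a ⊆ (R′ ⊕ g′) b)
      ⊕-⊈ J ℓ {R} {R′} g g′ R≢R′ g-within g′-within a b le = n≮n ∣ g a ∣ (begin-strict
        ∣ g a ∣                          ≤⟨ p⊆q⇒∣p∣≤∣q∣ (++-⊆⁻ʳ R R′ le) ⟩
        ∣ g′ b ∣                         ≤⟨ proj₂ (g′-within b) ⟩
        level J ℓ (height R′) + width J  <⟨ level-gap J ℓ (height-antitone (++-⊆⁻ˡ R R′ le) R≢R′) ⟩
        level J ℓ (height R)             ≤⟨ proj₁ (g-within a) ⟩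
        ∣ g a ∣                          ∎)
        where open ≤-Reasoning

      ⊕-unrelated : ∀ {n R} {g g′ : Fin p → Subset n} → Unrelated g g′ → Unrelated (R ⊕ g) (R ⊕ g′)
      ⊕-unrelated {R = R} u a b = (λ le → proj₁ (u a b) (++-⊆⁻ʳ R R le)) , (λ le → proj₂ (u a b) (++-⊆⁻ʳ R R le))

      AllPairs-All : {Q : A → Set} {R : A → A → Set} {xs : List A} → All Q xs → AllPairs R xs →
                     AllPairs (λ x y → (Q x × Q y) × R x y) xs
      AllPairs-All []       []         = []
      AllPairs-All (q ∷ qs) (rs ∷ rss) = All.zipWith (λ (qy , r) → (q , qy) , r) (qs , rs) ∷ AllPairs-All qs rss

    -- Two copies of f differ in sets T of one layer; copies behind the same R are unrelated by
    -- induction, behind different R by their heights; a copy of f and one behind R are treated by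
    -- `f-on-⊕-unrelated`.
    family-unrelated : ∀ J ℓ → AllPairs Unrelated (family J ℓ)
    family-unrelated zero    ℓ = []
    family-unrelated (suc J) ℓ = AllPairs.++⁺
      (AllPairs.map⁺ (AllPairs.map (λ ((T-size , T′-size) , T≢T′) → f-on-unrelated T-size T′-size T≢T′)
        (AllPairs-All sizes (Unique.filter⁺ (λ S → ∣ S ∣ ≟ level J ℓ (suc k)) (allSubsets-unique (dim J n₀))))))
      (AllPairs.concat⁺
        (All.map⁺ (All.universal (λ R → AllPairs.map⁺ (AllPairs.map ⊕-unrelated (family-unrelated J (level J ℓ (height R))))) outer))
        (AllPairs.map⁺ (AllPairs.map (λ {R} {R′} R≢R′ →
          All.map⁺ (All.map (λ {g} g-within → All.map⁺ (All.map (λ {g′} g′-within a b →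
              ⊕-⊈ J ℓ g g′ R≢R′ g-within g′-within a b , ⊕-⊈ J ℓ g′ g (R≢R′ ∘ sym) g′-within g-within b a)
            (family-within J (level J ℓ (height R′))))) (family-within J (level J ℓ (height R)))))
          (Unique.filter⁺ (¬? ∘ InClosure? f) (allSubsets-unique k)))))
      (All.map⁺ (All.map (λ T-size → All.concat⁺ (All.map⁺ (All.map (λ {R} R∉ →
          All.map⁺ (All.map (f-on-⊕-unrelated J ℓ T-size R∉) (family-within J (level J ℓ (height R))))) outer-∉)))
        sizes))
      where
      sizes : All (λ T → ∣ T ∣ ≡ level J ℓ (suc k)) (layer (dim J n₀) (level J ℓ (suc k)))
      sizes = All.all-filter (λ S → ∣ S ∣ ≟ level J ℓ (suc k)) (allSubsets (dim J n₀))

-- Lower bound: the number of copies constructed.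

half-+≤ : ∀ k n → (k + n) / 2 ≤ n / 2 + k
half-+≤ k n = begin
  (k + n) / 2       ≤⟨ /-monoˡ-≤ 2 (≤-trans (≤-reflexive (+-comm k n)) (+-monoʳ-≤ n (m≤m*n k 2))) ⟩
  (n + k * 2) / 2   ≡⟨ +-distrib-/-∣ʳ n {d = 2} (n∣m*n k) ⟩
  n / 2 + k * 2 / 2 ≡⟨ cong (n / 2 +_) (m*n/n≡m k 2) ⟩
  n / 2 + k         ∎
  where open ≤-Reasoning

-- The claim is void unless w < u, and then (u ∸ w) M ≤ (u ∸ w) q m ≤ q v.
rescale : ∀ q u w {v m M} → M ≤ q * m → u * m ≤ v + w * m → u * M ≤ q * v + w * M
rescale q u w {v} {m} {M} M≤qm h with ≤-total u w
... | inj₁ u≤w = m≤n⇒m≤o+n (q * v) (*-monoˡ-≤ M u≤w)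
... | inj₂ w≤u = begin
  u * M                     ≡⟨ cong (_* M) (m∸n+n≡m w≤u) ⟨
  (u ∸ w + w) * M           ≡⟨ *-distribʳ-+ M (u ∸ w) w ⟩
  (u ∸ w) * M + w * M       ≤⟨ +-monoˡ-≤ (w * M) (begin
    (u ∸ w) * M             ≤⟨ *-monoʳ-≤ (u ∸ w) M≤qm ⟩
    (u ∸ w) * (q * m)       ≡⟨ e (u ∸ w) q m ⟩
    q * ((u ∸ w) * m)       ≡⟨ cong (q *_) (*-distribʳ-∸ m u w) ⟩
    q * (u * m ∸ w * m)     ≤⟨ *-monoʳ-≤ q (m≤n+o⇒m∸n≤o (u * m) (w * m) (subst (u * m ≤_) (+-comm v (w * m)) h)) ⟩
    q * v                   ∎) ⟩
  q * v + w * M             ∎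
  where open ≤-Reasoning
        e : ∀ a b c → a * (b * c) ≡ b * (a * c)
        e = solve-∀

-- The gap M - N is nonnegative, so the weight n / 2 may be lowered to x. One x can then serve all
-- rounds, although their dimensions differ.
central≤C-near-centre-scaled : ∀ n d x → x ≤ n / 2 →
  x * (n C (n / 2)) ≤ x * (n C (n / 2 + d)) + d * d * (n C (n / 2))
central≤C-near-centre-scaled n d x x≤h = begin
  x * M                     ≡⟨ cong (x *_) (m+[n∸m]≡n (C-upper≤central n d)) ⟨
  x * (N + (M ∸ N))         ≡⟨ *-distribˡ-+ x N (M ∸ N) ⟩
  x * N + x * (M ∸ N)       ≤⟨ +-monoʳ-≤ (x * N) (*-monoˡ-≤ (M ∸ N) x≤h) ⟩
  x * N + n / 2 * (M ∸ N)   ≡⟨ cong (x * N +_) (*-distribˡ-∸ (n / 2) M N) ⟩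
  x * N + (n / 2 * M ∸ n / 2 * N) ≤⟨ +-monoʳ-≤ (x * N) (m≤n+o⇒m∸n≤o (n / 2 * M) (n / 2 * N) (central≤C-near-centre n d)) ⟩
  x * N + d * d * M         ∎
  where
  open ≤-Reasoning
  M = n C (n / 2)
  N = n C (n / 2 + d)

-- Bernoulli's inequality (1 + 1/b)^J ≥ 1 + J/b with J = a b, cleared of denominators.
^-dominates : ∀ b a → ∃ λ J → a * b ^ J ≤ suc b ^ J
-- The exponent 1 rather than 0, as 0 ^ 0 = 1.
^-dominates zero    a = 1 , ≤-trans (≤-reflexive (*-zeroʳ a)) z≤n
^-dominates (suc b) a = a * suc b , *-cancelʳ-≤ _ _ (suc b) (begin
  a * suc b ^ J * suc b           ≡⟨ e a (suc b ^ J) (suc b) ⟩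
  suc b ^ J * (a * suc b)         ≤⟨ *-monoʳ-≤ (suc b ^ J) (m≤n+m J (suc b)) ⟩
  suc b ^ J * (suc b + J)         ≤⟨ bernoulli (suc b) J ⟩
  suc (suc b) ^ J * suc b         ∎)
  where
  open ≤-Reasoning
  J = a * suc b
  e : ∀ a x b → a * x * b ≡ x * (a * b)
  e = solve-∀
  bernoulli : ∀ b J → b ^ J * (b + J) ≤ suc b ^ J * b
  bernoulli b zero    = ≤-reflexive (cong (1 *_) (+-identityʳ b))
  bernoulli b (suc J) = begin
    b * b ^ J * (b + suc J)                      ≡⟨ e₁ b (b ^ J) J ⟩
    b * (b ^ J * (b + J)) + b ^ J * b            ≤⟨ +-mono-≤ (*-monoʳ-≤ b (bernoulli b J)) (*-monoˡ-≤ b (^-monoˡ-≤ J (n≤1+n b))) ⟩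
    b * (suc b ^ J * b) + suc b ^ J * b          ≡⟨ e₂ b (suc b ^ J) ⟩
    suc b * suc b ^ J * b                        ∎
    where
    e₁ : ∀ b x j → b * x * (b + suc j) ≡ b * (x * (b + j)) + x * b
    e₁ b x j rewrite +-suc b j = e₃ b x (b + j)
      where e₃ : ∀ b x y → b * x * suc y ≡ b * (x * y) + x * b
            e₃ = solve-∀
    e₂ : ∀ b y → b * (y * b) + y * b ≡ suc b * y * b
    e₂ = solve-∀

module Density {p k : ℕ} (_≼_ : Fin p → Fin p → Set) (f : Fin p → Subset k)
               (f-embeds : IsWeakEmbedding _≼_ f) where

  open Packing _≼_ f f-embeds

  private
    q = 2 ^ k
    b = length outer
    c = closureSize f

  -- For positive x, division by x q^J M turns this into 1 - c t / M ≤ (b/q)^J + E / (x q^J), where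
  -- t is the number of copies. The constant E does not depend on x or n₀, so a large x makes the
  -- last term small. The slack B lets ℓ exceed the middle, as the recursion requires.
  family-density : ∀ J B → ∃ λ E → ∀ x n₀ ℓ → x ≤ n₀ / 2 →
    dim J n₀ / 2 ≤ ℓ → ℓ ≤ dim J n₀ / 2 + B →
    x * q ^ J * (dim J n₀ C (dim J n₀ / 2)) ≤
      x * q ^ J * c * length (family n₀ J ℓ) + (x * b ^ J + E) * (dim J n₀ C (dim J n₀ / 2))
  family-density zero B = 0 , λ x n₀ ℓ x≤ _ _ →
    m≤n⇒m≤o+n (x * 1 * c * 0) (*-monoˡ-≤ (n₀ C (n₀ / 2)) (m≤m+n (x * 1) 0))
  family-density (suc J) B = c * q ^ J * (B₁ * B₁) + b * E₀ , bound
    where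
    -- Removing the block lowers the middle by at most k, and the level rises by at most the largest
    -- shift.
    B₁ = (B + k) + suc (width J) * (k + 2 * suc k)
    IH = family-density J B₁
    E₀ = proj₁ IH
    bound : ∀ x n₀ ℓ → x ≤ n₀ / 2 →
      dim (suc J) n₀ / 2 ≤ ℓ → ℓ ≤ dim (suc J) n₀ / 2 + B →
      x * q ^ suc J * (dim (suc J) n₀ C (dim (suc J) n₀ / 2)) ≤
        x * q ^ suc J * c * length (family n₀ (suc J) ℓ)
          + (x * b ^ suc J + (c * q ^ J * (B₁ * B₁) + b * E₀)) * (dim (suc J) n₀ C (dim (suc J) n₀ / 2))
    bound x n₀ ℓ x≤ h≤ℓ ℓ≤ = begin
      x * q ^ suc J * M                              ≡⟨ cong (λ q′ → x * (q′ * q ^ J) * M) (sym length-outer) ⟩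
      -- As q = b + c, the left side splits: c shares are paid by the layer of copies of f, and one
      -- share by each of the b sets R.
      x * ((b + c) * q ^ J) * M                      ≡⟨ e₁ x b c (q ^ J) M ⟩
      c * q ^ J * (x * M) + b * (x * q ^ J * M)      ≤⟨ +-mono-≤ (*-monoʳ-≤ (c * q ^ J) main-bound) outer-bound ⟩
      c * q ^ J * (q * (x * N) + B₁ * B₁ * M) + (q * (x * q ^ J * c * Σt) + b * ((x * b ^ J + E₀) * M))
                                                     ≡⟨ e₂ x q c (q ^ J) b (b ^ J) (B₁ * B₁) E₀ M N Σt ⟩
      x * q ^ suc J * c * (N + Σt) + (x * b ^ suc J + (c * q ^ J * (B₁ * B₁) + b * E₀)) * M
                                                     ≡⟨ cong (λ l → x * q ^ suc J * c * l + (x * b ^ suc J + (c * q ^ J * (B₁ * B₁) + b * E₀)) * M)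
                                                             (length-family-suc n₀ J ℓ) ⟨
      x * q ^ suc J * c * length (family n₀ (suc J) ℓ) + (x * b ^ suc J + (c * q ^ J * (B₁ * B₁) + b * E₀)) * M ∎
      where
      open ≤-Reasoning
      n = dim (suc J) n₀
      n′ = dim J n₀
      M = n C (n / 2)
      M′ = n′ C (n′ / 2)
      N = n′ C level J ℓ (suc k)
      t : Subset k → ℕ
      t R = length (family n₀ J (level J ℓ (height R)))
      Σt = ∑ outer t

      e₁ : ∀ x b c y m → x * ((b + c) * y) * m ≡ c * y * (x * m) + b * (x * y * m)
      e₁ = solve-∀
      e₂ : ∀ x q c y b z d e m N s →
        c * y * (q * (x * N) + d * m) + (q * (x * y * c * s) + b * ((x * z + e) * m))
          ≡ x * (q * y) * c * (N + s) + (x * (b * z) + (c * y * d + b * e)) * m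
      e₂ = solve-∀

      M≤ : M ≤ q * M′
      M≤ = central-+≤ k n′

      h′≤ℓ : n′ / 2 ≤ ℓ
      h′≤ℓ = ≤-trans (/-monoˡ-≤ 2 (m≤n+m n′ k)) h≤ℓ

      ℓ≤′ : ℓ ≤ n′ / 2 + (B + k)
      ℓ≤′ = begin
        ℓ                     ≤⟨ ℓ≤ ⟩
        n / 2 + B             ≤⟨ +-monoˡ-≤ B (half-+≤ k n′) ⟩
        n′ / 2 + k + B        ≡⟨ +-assoc (n′ / 2) k B ⟩
        n′ / 2 + (k + B)      ≡⟨ cong (n′ / 2 +_) (+-comm k B) ⟩
        n′ / 2 + (B + k)      ∎

      level≤ : ∀ {h} → h ≤ k + 2 * suc k → level J ℓ h ≤ n′ / 2 + B₁
      level≤ h≤ = ≤-trans (+-mono-≤ ℓ≤′ (*-monoʳ-≤ (suc (width J)) h≤)) (≤-reflexive (+-assoc (n′ / 2) (B + k) _))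

      -- The layer used lies at most B₁ above the middle of the smaller cube, hence has nearly M′
      -- members; `rescale` passes from M′ to M.
      main-bound : x * M ≤ q * (x * N) + B₁ * B₁ * M
      main-bound = rescale q x (B₁ * B₁) M≤ (begin
        x * M′                          ≤⟨ central≤C-near-centre-scaled n′ d x (≤-trans x≤ (/-monoˡ-≤ 2 (dim≥ J))) ⟩
        x * (n′ C (n′ / 2 + d)) + d * d * M′ ≤⟨ +-mono-≤ (≤-reflexive (cong (λ r → x * (n′ C r)) (m+[n∸m]≡n h≤r)))
                                                          (*-monoˡ-≤ M′ (*-mono-≤ d≤ d≤)) ⟩
        x * N + B₁ * B₁ * M′            ∎)
        where
        r = level J ℓ (suc k)
        d = r ∸ n′ / 2
        h≤r : n′ / 2 ≤ r
        h≤r = m≤n⇒m≤n+o _ h′≤ℓ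
        d≤ : d ≤ B₁
        d≤ = m≤n+o⇒m∸n≤o r (n′ / 2) (level≤ (≤-trans (m≤m+n (suc k) _) (m≤n+m (2 * suc k) k)))
        dim≥ : ∀ J → n₀ ≤ dim J n₀
        dim≥ zero    = ≤-refl
        dim≥ (suc J) = ≤-trans (dim≥ J) (m≤n+m _ k)

      outer-bound : b * (x * q ^ J * M) ≤ q * (x * q ^ J * c * Σt) + b * ((x * b ^ J + E₀) * M)
      outer-bound = begin
        b * (x * q ^ J * M)                          ≡⟨ ∑-const outer (x * q ^ J * M) ⟨
        ∑[ R ∈ outer ] x * q ^ J * M                 ≤⟨ ∑-mono outer (λ R → rescale q (x * q ^ J) (x * b ^ J + E₀) M≤
                                                          (proj₂ IH x n₀ (level J ℓ (height R)) x≤ (m≤n⇒m≤n+o _ h′≤ℓ) (level≤ (height≤ R)))) ⟩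
        ∑[ R ∈ outer ] (q * (x * q ^ J * c * t R) + (x * b ^ J + E₀) * M)
                                                     ≡⟨ ∑-+ outer (λ R → q * (x * q ^ J * c * t R)) (λ _ → (x * b ^ J + E₀) * M) ⟩
        (∑[ R ∈ outer ] q * (x * q ^ J * c * t R)) + ∑[ R ∈ outer ] (x * b ^ J + E₀) * M
                                                     ≡⟨ cong₂ _+_ (trans (∑-*ˡ outer q (λ R → x * q ^ J * c * t R)) (cong (q *_) (∑-*ˡ outer (x * q ^ J * c) t)))
                                                                  (∑-const outer ((x * b ^ J + E₀) * M)) ⟩
        q * (x * q ^ J * c * Σt) + b * ((x * b ^ J + E₀) * M) ∎

  #copies≥ : 1 ≤ c → ∀ e → ∃ λ J → ∃ λ N → ∀ n₀ → N ≤ n₀ →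
    suc e * (dim J n₀ C (dim J n₀ / 2)) ≤
      suc e * (c * length (family n₀ J (dim J n₀ / 2))) + (dim J n₀ C (dim J n₀ / 2))
  -- The threshold 2x ensures x ≤ n₀ / 2.
  #copies≥ 1≤c e = J , x * 2 , λ n₀ N≤n₀ → bound n₀ (subst (_≤ n₀ / 2) (m*n/n≡m x 2) (/-monoˡ-≤ 2 N≤n₀))
    where
    a = 2 * suc e
    J = proj₁ (^-dominates b a)
    ab^J≤q^J : a * b ^ J ≤ q ^ J
    -- Since c ≥ 1, b + 1 ≤ b + c = q.
    ab^J≤q^J = ≤-trans (proj₂ (^-dominates b a)) (^-monoˡ-≤ J (≤-trans (≤-reflexive (+-comm 1 b)) (≤-trans (+-monoʳ-≤ b 1≤c) (≤-reflexive length-outer))))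
    E = proj₁ (family-density J 0)
    x = a * suc E
    instance
      x≢0 : NonZero x
      x≢0 = m*n≢0 a (suc E)
      q^J≢0 : NonZero (q ^ J)
      q^J≢0 = m^n≢0 q J {{m^n≢0 2 k}}
    y = x * q ^ J
    bound : ∀ n₀ → x ≤ n₀ / 2 → let M = dim J n₀ C (dim J n₀ / 2) in
      suc e * M ≤ suc e * (c * length (family n₀ J (dim J n₀ / 2))) + M
    bound n₀ x≤ = *-cancelˡ-≤ (2 * y) {{m*n≢0 2 y {{_}} {{m*n≢0 x (q ^ J)}}}} (begin
      2 * y * (suc e * M)                                     ≡⟨ e₁ (suc e) y M ⟩
      a * (y * M)                                             ≤⟨ *-monoʳ-≤ a (proj₂ (family-density J 0) x n₀ (dim J n₀ / 2) x≤ ≤-refl (m≤m+n _ 0)) ⟩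
      a * (y * c * t + (x * b ^ J + E) * M)                   ≡⟨ e₂ a y c t x (b ^ J) E M ⟩
      a * (y * c * t) + (x * (a * b ^ J) + a * E) * M         ≤⟨ +-monoʳ-≤ (a * (y * c * t)) (*-monoˡ-≤ M (+-mono-≤ (*-monoʳ-≤ x ab^J≤q^J) aE≤y)) ⟩
      a * (y * c * t) + (y + y) * M                           ≡⟨ e₃ (suc e) y c t M ⟩
      2 * y * (suc e * (c * t) + M)                           ∎)
      where
      open ≤-Reasoning
      M = dim J n₀ C (dim J n₀ / 2)
      t = length (family n₀ J (dim J n₀ / 2))
      aE≤y : a * E ≤ y
      aE≤y = ≤-trans (*-monoʳ-≤ a (n≤1+n E)) (m≤m*n x (q ^ J))
      e₁ : ∀ s y m → 2 * y * (s * m) ≡ 2 * s * (y * m)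
      e₁ = solve-∀
      e₂ : ∀ a y c t x z E m → a * (y * c * t + (x * z + E) * m) ≡ a * (y * c * t) + (x * (a * z) + a * E) * m
      e₂ = solve-∀
      e₃ : ∀ s y c t m → 2 * s * (y * c * t) + (y + y) * m ≡ 2 * y * (s * (c * t) + m)
      e₃ = solve-∀

  family-achievable : ∀ J n₀ ℓ → ∃ λ m → Achievable _≼_ (dim J n₀) m × length (family n₀ J ℓ) * p ≤ m
  family-achievable J n₀ ℓ = unionSize F , (length (family n₀ J ℓ) , F , embeds , unrelated , refl) , unionSize≥ F F-inj
    where
    F = lookup (family n₀ J ℓ)
    embeds : ∀ i → IsWeakEmbedding _≼_ (F i)
    embeds i = All.lookup (family-embeds n₀ J ℓ) (∈-lookup i)
    unrelated : PairwiseUnrelated F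
    unrelated i j i≢j = AllPairs-lookup (λ {g} {h} → Unrelated-sym {g = g} {h}) (family-unrelated n₀ J ℓ) i≢j
    F-inj : ∀ {i j a b} → F i a ≡ F j b → i ≡ j × a ≡ b
    F-inj {i} {j} {a} {b} eq with i ≟ᶠ j
    ... | yes refl = refl , proj₁ (embeds i) a b eq
    ... | no  i≢j  = ⊥-elim (proj₁ (unrelated i j i≢j a b) (⊆-reflexive eq))

-- The two bounds in asymptotic form, and the theorem.

closureSize≥1 : ∀ {p k} (f : Fin (suc p) → Subset k) → 1 ≤ closureSize f
closureSize≥1 f = filter-some (InClosure? f)
  (lose (allSubsets-complete (f Fin.zero)) (Fin.zero , Fin.zero , (λ {_} → ⊆-refl) , (λ {_} → ⊆-refl)))

*∣-∣≤ : ∀ s {x y z} → s * x ≤ s * y + z → s * y ≤ s * x + z → s * ∣ x - y ∣ ≤ z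
*∣-∣≤ s {x} {y} {z} h₁ h₂ with ≤-total x y
... | inj₁ x≤y = begin
  s * ∣ x - y ∣    ≡⟨ cong (s *_) (m≤n⇒∣m-n∣≡n∸m x≤y) ⟩
  s * (y ∸ x)      ≡⟨ *-distribˡ-∸ s y x ⟩
  s * y ∸ s * x    ≤⟨ m≤n+o⇒m∸n≤o (s * y) (s * x) h₂ ⟩
  z                ∎
  where open ≤-Reasoning
... | inj₂ y≤x = begin
  s * ∣ x - y ∣    ≡⟨ cong (s *_) (m≤n⇒∣n-m∣≡n∸m y≤x) ⟩
  s * (x ∸ y)      ≡⟨ *-distribˡ-∸ s x y ⟩
  s * x ∸ s * y    ≤⟨ m≤n+o⇒m∸n≤o (s * x) (s * y) h₁ ⟩
  z                ∎
  where open ≤-Reasoning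

module _ {p : ℕ} (_≼_ : Fin p → Fin p → Set) {c : ℕ} (1≤c : 1 ≤ c) where

  private
    1≤k : ∀ e → 1 ≤ c + c * e
    1≤k e = ≤-trans 1≤c (m≤m+n c (c * e))

  LaSharp-upper : ((k : ℕ) (f : Fin p → Subset k) → IsWeakEmbedding _≼_ f → c ≤ closureSize f) →
    ∀ e → ∃ λ N → ∀ n → N ≤ n → ∀ L → Achievable _≼_ n L →
    suc e * (L * c) ≤ suc e * (p * (n C (n / 2))) + p * (n C (n / 2))
  LaSharp-upper c-min e = (c + d) * c + (c + d) , bound
    where
    d = c * suc e
    bound : ∀ n → (c + d) * c + (c + d) ≤ n → ∀ L → Achievable _≼_ n L →
      suc e * (L * c) ≤ suc e * (p * (n C (n / 2))) + p * (n C (n / 2))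
    bound n large L (t , F , embeds , unrelated , refl) = *-cancelˡ-≤ c {{>-nonZero 1≤c}} (begin
      c * (suc e * (unionSize F * c))    ≤⟨ *-monoʳ-≤ c (*-monoʳ-≤ (suc e) (*-monoˡ-≤ c (unionSize≤ F))) ⟩
      c * (suc e * (t * p * c))          ≡⟨ e₁ c (suc e) t p ⟩
      p * (t * (c * d))                  ≤⟨ *-monoʳ-≤ p (#copies≤ F unrelated c d (1≤k (suc e)) large (λ i → c-min n (F i) (embeds i))) ⟩
      p * ((c + d) * M)                  ≡⟨ e₂ p c (suc e) M ⟩
      c * (suc e * (p * M) + p * M)      ∎)
      where
      open ≤-Reasoning
      M = n C (n / 2)
      e₁ : ∀ c s t p → c * (s * (t * p * c)) ≡ p * (t * (c * (c * s)))
      e₁ = solve-∀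
      e₂ : ∀ p c s m → p * ((c + c * s) * m) ≡ c * (s * (p * m) + p * m)
      e₂ = solve-∀

  LaSharp-lower : ∀ {k} (f : Fin p → Subset k) → IsWeakEmbedding _≼_ f → closureSize f ≡ c →
    ∀ e → ∃ λ N → ∀ n → N ≤ n → ∀ L → (∀ m → Achievable _≼_ n m → m ≤ L) →
    suc e * (p * (n C (n / 2))) ≤ suc e * (L * c) + p * (n C (n / 2))
  LaSharp-lower f f-embeds refl e = dim J 0 + N , bound
    where
    open Packing _≼_ f f-embeds
    open Density _≼_ f f-embeds
    copies = #copies≥ 1≤c e
    J = proj₁ copies
    N = proj₁ (proj₂ copies)
    Bound : ℕ → Set
    Bound n = ∀ L → (∀ m → Achievable _≼_ n m → m ≤ L) →
      suc e * (p * (n C (n / 2))) ≤ suc e * (L * c) + p * (n C (n / 2))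
    bound-dim : ∀ n₀ → N ≤ n₀ → Bound (dim J n₀)
    bound-dim n₀ N≤n₀ L L-max = begin
      suc e * (p * M)                    ≡⟨ e₁ (suc e) p M ⟩
      p * (suc e * M)                    ≤⟨ *-monoʳ-≤ p (proj₂ (proj₂ copies) n₀ N≤n₀) ⟩
      p * (suc e * (c * t) + M)          ≡⟨ e₂ p (suc e) c t M ⟩
      suc e * (t * p * c) + p * M        ≤⟨ +-monoˡ-≤ (p * M) (*-monoʳ-≤ (suc e) (*-monoˡ-≤ c tp≤L)) ⟩
      suc e * (L * c) + p * M            ∎
      where
      open ≤-Reasoning
      M = dim J n₀ C (dim J n₀ / 2)
      t = length (family n₀ J (dim J n₀ / 2))
      tp≤L : t * p ≤ L
      tp≤L with m , achieved , tp≤m ← family-achievable J n₀ (dim J n₀ / 2) = ≤-trans tp≤m (L-max m achieved)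
      e₁ : ∀ s p m → s * (p * m) ≡ p * (s * m)
      e₁ = solve-∀
      e₂ : ∀ p s c t m → p * (s * (c * t) + m) ≡ s * (t * p * c) + p * m
      e₂ = solve-∀
    bound : ∀ n → dim J 0 + N ≤ n → Bound n
    -- J is fixed by e, so every n ≥ `dim J 0` is `dim J n₀` with n₀ = n - `dim J 0`, and n₀ is
    -- large with n.
    bound n le = subst Bound (trans (dim≡ J (n ∸ dim J 0)) (m+[n∸m]≡n (m+n≤o⇒m≤o (dim J 0) le)))
      (bound-dim (n ∸ dim J 0) (m+n≤o⇒m≤o∸n N (subst (_≤ n) (+-comm (dim J 0) N) le)))

-- For p > 0 the ratio of L c to p M is within 1 / (e + 1) of 1 for all large n; as e is arbitrary,
-- this is the asymptotic equality with denominators cleared.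
theorem3 : (p : ℕ) (_≼_ : Fin p → Fin p → Set) → IsPartialOrder _≡_ _≼_ →
    (c : ℕ) → IsC _≼_ c →
    (e : ℕ) → ∃ λ (N : ℕ) → (n : ℕ) → N ≤ n → (L : ℕ) → IsLaSharp _≼_ n L →
    suc e * ∣ L * c - p * (n C (n / 2)) ∣ ≤ p * (n C (n / 2))
-- The empty poset is separate, as its c is 0: copies are empty, hence L = 0 and both sides vanish.
theorem3 zero _≼_ po c isC e = 0 , λ n _ L ((t , F , _ , _ , size≡L) , _) →
  let L≡0 : L ≡ 0
      L≡0 = n≤0⇒n≡0 (subst₂ _≤_ size≡L (*-zeroʳ t) (unionSize≤ F))
  in ≤-reflexive (trans (cong (λ l → suc e * ∣ l * c - 0 ∣) L≡0) (*-zeroʳ (suc e)))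
theorem3 p@(suc _) _≼_ po c ((k , f , f-embeds , size≡c) , c-min) e =
  N₁ ⊔ N₂ , λ n N≤n L (achieved , L-max) → *∣-∣≤ (suc e)
    (proj₂ upper n (≤-trans (m≤m⊔n N₁ N₂) N≤n) L achieved)
    (proj₂ lower n (≤-trans (m≤n⊔m N₁ N₂) N≤n) L L-max)
  where
  1≤c : 1 ≤ c
  1≤c = subst (1 ≤_) size≡c (closureSize≥1 f)
  upper = LaSharp-upper _≼_ 1≤c c-min e
  lower = LaSharp-lower _≼_ 1≤c f f-embeds size≡c e
  N₁ = proj₁ upper
  N₂ = proj₁ lower
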